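{- Let $\mu$ be a strict partition of $m$ and let $f\in\Gamma$ be a supersymmetric function. Then $$\mathbb{E}_{\mu,n}[f]=\sum_{\lambda\in\mathcal{SP}_{n+m}}\frac{m!}{(n+m)!}\,2^{n-\ell(\lambda)+\ell(\mu)}\,\frac{g^\lambda}{g^\mu}\,g^{\lambda/\mu}\,f(\lambda)$$ is a polynomial function in $n$ (i.e. agrees with a fixed polynomial in $n$ for all integers $n\ge0$).
   Context: A partition is a finite weakly decreasing sequence $\lambda=(\lambda_1,\dots,\lambda_l)$ of positive integers; $\ell(\lambda)=l$, $|\lambda|=\sum_i\lambda_i$. It is strict if all parts are distinct; $\mathcal{SP}_n$ is the set of strict partitions of $n$ ($\mathcal{SP}_0=\{\emptyset\}$). The shifted Young diagram of strict $\lambda$ is $S(\lambda)=\{(i,j)\in\mathbb{Z}^2:1\le i\le\ell(\lambda),\ i\le j\le\lambda_i+i-1\}$. For strict $\lambda,\mu$ with $S(\lambda)\supseteq S(\mu)$ and $k=|\lambda|-|\mu|$, $g^{\lambda/\mu}$ is the number of sequences $\mu=\lambda^{(0)},\dots,\lambda^{(k)}=\lambda$ of strict partitions with each $S(\lambda^{(i)})$ obtained from $S(\lambda^{(i-1)})$ by adding exactly one box; $g^{\lambda/\mu}=0$ if $S(\lambda)\not\supseteq S(\mu)$; $g^\lambda=g^{\lambda/\emptyset}$. $p_r=x_1^r+x_2^r+\cdots$ is the power sum; $\Gamma$ is the $\mathbb{Q}$-subalgebra of symmetric functions generated by $p_1,p_3,p_5,\dots$ (supersymmetric functions). For $f\in\Gamma$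 and strict $\lambda$, $f(\lambda)=f(\lambda_1,\dots,\lambda_{\ell(\lambda)},0,0,\dots)$. -}

module Defs where

open import Data.Nat as ℕ using (ℕ; zero; suc; _∸_; _≡ᵇ_; _≤ᵇ_; _<_)
open import Data.Nat using (_!)
open import Data.Integer using (+_)
open import Data.Rational using (ℚ; 0ℚ; 1ℚ; _+_; _*_; _/_)
open import Data.Bool using (Bool; true; false; _∧_; if_then_else_)
open import Data.List using (List; []; _∷_; _++_; map; length)
open import Data.Nat.ListAction using (sum)
open import Data.List.Relation.Unary.All using (All)
open import Data.List.Relation.Unary.Linked using (Linked)

IsStrict : List ℕ → Set
IsStrict λ′ = All (0 <_) λ′ × Linked (λ a b → b < a) λ′
  where open import Data.Product using (_×_)

size : List ℕ → ℕ
size = sum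

sp : ℕ → ℕ → List (List ℕ)
sp n zero = if n ≡ᵇ 0 then ([] ∷ []) else []
sp n (suc b) = sp n b ++
  (if suc b ≤ᵇ n then map (suc b ∷_) (sp (n ∸ suc b) b) else [])

SP : ℕ → List (List ℕ)
SP N = sp N N

-- S(λ) ⊆ S(ν) for shifted Young diagrams: row i of S(λ) is the set of
-- columns i … λᵢ+i-1, so containment holds iff ℓ(λ) ≤ ℓ(ν) and λᵢ ≤ νᵢ.
shiftedSub : List ℕ → List ℕ → Bool
shiftedSub [] _ = true
shiftedSub (_ ∷ _) [] = false
shiftedSub (a ∷ as) (b ∷ bs) = (a ≤ᵇ b) ∧ shiftedSub as bs

addsOneBox : List ℕ → List ℕ → Bool
addsOneBox λ′ ν = shiftedSub λ′ ν ∧ (size ν ≡ᵇ suc (size λ′))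

eqList : List ℕ → List ℕ → Bool
eqList [] [] = true
eqList [] (_ ∷ _) = false
eqList (_ ∷ _) [] = false
eqList (a ∷ as) (b ∷ bs) = (a ≡ᵇ b) ∧ eqList as bs

chains : ℕ → List ℕ → List ℕ → ℕ
chains zero ν λ′ = if eqList ν λ′ then 1 else 0
chains (suc k) ν λ′ =
  sum (map (λ ν′ → if addsOneBox ν ν′ then chains k ν′ λ′ else 0)
           (SP (suc (size ν))))

-- g^{λ/μ} (k = |λ| - |μ|); it is 0 when S(λ) ⊉ S(μ)
gskew : List ℕ → List ℕ → ℕ
gskew λ′ μ = chains (size λ′ ∸ size μ) μ λ′

g : List ℕ → ℕ
g λ′ = gskew λ′ []

ℕtoℚ : ℕ → ℚ
ℕtoℚ n = (+ n) / 1

-- q / d (total; only ever used with d > 0)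
divℕ : ℚ → ℕ → ℚ
divℕ q zero = 0ℚ
divℕ q (suc d) = q * ((+ 1) / suc d)

powℚ : ℚ → ℕ → ℚ
powℚ q zero = 1ℚ
powℚ q (suc k) = q * powℚ q k

sumℚ : List ℚ → ℚ
sumℚ [] = 0ℚ
sumℚ (x ∷ xs) = x + sumℚ xs

-- Γ : the ℚ-algebra generated by p₁, p₃, p₅, …  Its elements are
-- exactly the values of polynomial expressions in the odd power sums.

data Γ : Set where
  const : ℚ → Γ
  pOdd  : ℕ → Γ          -- pOdd k = p_{2k+1}
  _⊕_   : Γ → Γ → Γ
  _⊗_   : Γ → Γ → Γ

-- power sum p_r(λ) = Σᵢ λᵢ^r  (trailing zeros contribute nothing)
powerSum : ℕ → List ℕ → ℚ
powerSum r λ′ = sumℚ (map (λ a → powℚ (ℕtoℚ a) r) λ′)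

evalΓ : Γ → List ℕ → ℚ
evalΓ (const c) λ′ = c
evalΓ (pOdd k) λ′ = powerSum (suc (2 ℕ.* k)) λ′
evalΓ (f ⊕ h) λ′ = evalΓ f λ′ + evalΓ h λ′
evalΓ (f ⊗ h) λ′ = evalΓ f λ′ * evalΓ h λ′

-- 𝔼_{μ,n}[f] = Σ_{λ ∈ 𝒮𝒫_{n+m}} m!/(n+m)! · 2^{n-ℓ(λ)+ℓ(μ)} · g^λ/g^μ · g^{λ/μ} · f(λ)
-- with m = |μ|; 2^{n-ℓ(λ)+ℓ(μ)} is written 2^{n+ℓ(μ)} / 2^{ℓ(λ)}.

expect : List ℕ → ℕ → Γ → ℚ
expect μ n f =
  sumℚ (map term (SP (n ℕ.+ size μ)))
  where
    term : List ℕ → ℚ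
    term λ′ = divℕ (ℕtoℚ ((size μ) ! ℕ.* 2 ℕ.^ (n ℕ.+ length μ)
                          ℕ.* g λ′ ℕ.* gskew λ′ μ) * evalΓ f λ′)
                   (((n ℕ.+ size μ) !) ℕ.* 2 ℕ.^ length λ′ ℕ.* g μ)

evalPoly : List ℚ → ℕ → ℚ
evalPoly [] n = 0ℚ
evalPoly (c ∷ cs) n = c + ℕtoℚ n * evalPoly cs n

{-# OPTIONS --safe #-}

-- Write u_x = x (x + 1) and, for a strict partition λ, Φ(u) = u⁻¹ ∏ (u - u_{y-1}) / (u - u_y) over the
-- parts y of λ. The residue of Φ at u_y is the probability that the shifted Plancherel growth process
-- adds its next box to the row of length y (at u = 0: a new row), and the residues of 1 / (u Φ(u)) are
-- the ratios g^{λ⁻} / g^λ up to an explicit factor, which gives the shifted hook formula. Hence the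
-- moments Σ p u^K of the transition measure are the Taylor coefficients of Φ at infinity, and by
-- Newton's identities they are polynomials in the P_k(λ) = Σ_{boxes} (content)^k, which generate Γ.
-- With P_k in degree k + 1 the K-th moment has degree ≤ K, so f ↦ 𝔼[f(λ⁺)] - f(λ) lowers the degree.
-- Thus 𝔼_{μ,n}[f] has vanishing iterated differences in n and is a polynomial by Newton's formula.
module Submission where

open import Defs
open import Data.Bool using (Bool; true; false; _∧_; if_then_else_; T)
open import Data.Bool.Properties using (T-≡)
import Data.Integer as ℤ
import Data.Integer.Properties as ℤ
open import Data.List using (List; []; _∷_; _++_; map; length)
open import Data.List.Relation.Unary.All as All using (All; []; _∷_)
import Data.List.Relation.Unary.All.Properties as All
open import Data.List.Relation.Unary.Linked using (Linked; [-]; _∷_)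
open import Data.Maybe using (Maybe; just; nothing)
open import Data.Nat using (ℕ)
open import Data.Nat as ℕ using (zero; suc; _∸_; _≡ᵇ_; _≤ᵇ_; _<_; _≤_; s≤s; z≤n; _!)
open import Data.Nat.ListAction using (sum)
import Data.Nat.Properties as ℕ
open import Data.Product using (Σ; ∃; _×_; _,_)
open import Data.Rational using (ℚ; 0ℚ; 1ℚ; ½; _+_; _*_; _-_; -_; 1/_; _/_; ≢-nonZero; toℚᵘ)
open import Data.Rational.Properties using
  (_≟_; +-*-commutativeRing; toℚᵘ-injective; toℚᵘ-homo-+; toℚᵘ-homo-*; toℚᵘ-fromℚᵘ; *-inverseˡ; neg-distribˡ-*;
   *-zeroʳ; *-zeroˡ; *-identityˡ; *-identityʳ; *-comm; *-assoc; +-identityˡ; +-identityʳ; +-comm; +-assoc)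
import Data.Rational.Unnormalised as ℚᵘ
import Data.Rational.Unnormalised.Properties as ℚᵘ
open import Data.Sum using (_⊎_; inj₁; inj₂)
open import Function using (_∘_)
open import Function.Bundles using (Equivalence)
open import Level using (0ℓ)
open import Relation.Binary.Definitions using (tri<; tri≈; tri>)
open import Relation.Binary.PropositionalEquality
open import Relation.Nullary using (yes; no; contradiction)
open import Tactic.RingSolver using (solve-∀)
open import Tactic.RingSolver.Core.AlmostCommutativeRing using (AlmostCommutativeRing; fromCommutativeRing)
open ≡-Reasoning

-- Rational arithmetic and finite sums

-- No residue calculus is used: a rational function is carried as the list of its poles, its
-- residues and the partitions they lead to, and a new largest row multiplies it by one factor
-- `(u - n) / (u - d)`, so identities about `Φ` become inductions over rows. The obstacle is
-- strictness. A move that makes two neighbouring rows equal stays in the list. It is harmless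
-- because `α z` equals `β (suc z)`, so a numerator vanishes at that pole and the residue is 0, and
-- because the weight `W` of its target contains a factor `y - y`. Sums over moves and sums over
-- `SP` therefore agree for functions that vanish with `W`. The degree `k + 1` of `P k` comes from
-- its increment `u ^ k` under a new box of content `u`: the mean of `u ^ k` has degree at most `k`,
-- one less than `P k`, while constants disappear because the residues of `Φ` add up to 1.

ℚ-ring : AlmostCommutativeRing 0ℓ 0ℓ
ℚ-ring = fromCommutativeRing +-*-commutativeRing isZero
  where
  isZero : ∀ x → Maybe (0ℚ ≡ x)
  isZero x with 0ℚ ≟ x
  ... | yes p = just p
  ... | no  _ = nothing

-- Total inverse, with inv 0 = 0.
inv : ℚ → ℚ
inv x with x ≟ 0ℚ
... | yes _  = 0ℚ
... | no x≢0 = 1/_ x {{≢-nonZero x≢0}}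

inv-* : ∀ {x} → x ≢ 0ℚ → inv x * x ≡ 1ℚ
inv-* {x} x≢0 with x ≟ 0ℚ
... | yes x≡0 = contradiction x≡0 x≢0
... | no  x≢0 = *-inverseˡ x {{≢-nonZero x≢0}}

inv-unique : ∀ {x y} → y * x ≡ 1ℚ → inv x ≡ y
inv-unique {x} {y} yx = begin
  inv x            ≡⟨ sym (*-identityˡ _) ⟩
  1ℚ * inv x       ≡⟨ cong (_* inv x) (sym yx) ⟩
  y * x * inv x    ≡⟨ *-assoc y x _ ⟩
  y * (x * inv x)  ≡⟨ cong (y *_) (trans (*-comm x _) (inv-* x≢0)) ⟩
  y * 1ℚ           ≡⟨ *-identityʳ y ⟩
  y ∎
  where
  x≢0 : x ≢ 0ℚ
  x≢0 refl with () ← trans (sym yx) (*-zeroʳ y)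

inv-distrib-* : ∀ x y → inv (x * y) ≡ inv x * inv y
inv-distrib-* x y = go (x ≟ 0ℚ) (y ≟ 0ℚ)
  where
  rearrange : ∀ x y i j → i * j * (x * y) ≡ (i * x) * (j * y)
  rearrange = solve-∀ ℚ-ring
  go : _ → _ → inv (x * y) ≡ inv x * inv y
  go (yes refl) _ = trans (cong inv (*-zeroˡ y)) (sym (*-zeroˡ (inv y)))
  go (no _) (yes refl) = trans (cong inv (*-zeroʳ x)) (sym (*-zeroʳ (inv x)))
  go (no x≢0) (no y≢0) = inv-unique (trans (rearrange x y (inv x) (inv y)) (cong₂ _*_ (inv-* x≢0) (inv-* y≢0)))

*-≢0 : ∀ {x y} → x ≢ 0ℚ → y ≢ 0ℚ → x * y ≢ 0ℚ
*-≢0 {x} {y} x≢0 y≢0 xy≡0 = y≢0 (begin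
  y                ≡⟨ sym (*-identityˡ y) ⟩
  1ℚ * y           ≡⟨ cong (_* y) (sym (inv-* x≢0)) ⟩
  inv x * x * y    ≡⟨ *-assoc (inv x) x y ⟩
  inv x * (x * y)  ≡⟨ cong (inv x *_) xy≡0 ⟩
  inv x * 0ℚ       ≡⟨ *-zeroʳ (inv x) ⟩
  0ℚ ∎)

*-cancelˡ : ∀ {x y z} → x ≢ 0ℚ → x * y ≡ x * z → y ≡ z
*-cancelˡ {x} {y} {z} x≢0 eq = begin
  y                ≡⟨ undo y ⟩
  inv x * (x * y)  ≡⟨ cong (inv x *_) eq ⟩
  inv x * (x * z)  ≡⟨ sym (undo z) ⟩
  z ∎
  where
  undo : ∀ w → w ≡ inv x * (x * w)
  undo w = trans (sym (*-identityˡ w)) (trans (cong (_* w) (sym (inv-* x≢0))) (*-assoc (inv x) x w))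

private
  toℚᵘ-ℕtoℚ : ∀ n → toℚᵘ (ℕtoℚ n) ℚᵘ.≃ ℚᵘ.mkℚᵘ (ℤ.+ n) 0
  toℚᵘ-ℕtoℚ n = toℚᵘ-fromℚᵘ (ℚᵘ.mkℚᵘ (ℤ.+ n) 0)

ℕtoℚ-+ : ∀ m n → ℕtoℚ (m ℕ.+ n) ≡ ℕtoℚ m + ℕtoℚ n
ℕtoℚ-+ m n = toℚᵘ-injective (ℚᵘ.≃-trans (toℚᵘ-ℕtoℚ (m ℕ.+ n)) (ℚᵘ.≃-trans (ℚᵘ.*≡* eq)
    (ℚᵘ.≃-sym (ℚᵘ.≃-trans (toℚᵘ-homo-+ (ℕtoℚ m) (ℕtoℚ n)) (ℚᵘ.+-cong (toℚᵘ-ℕtoℚ m) (toℚᵘ-ℕtoℚ n))))))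
  where
  eq : ℤ.+ (m ℕ.+ n) ℤ.* ℤ.+ 1 ≡ (ℤ.+ m ℤ.* ℤ.+ 1 ℤ.+ ℤ.+ n ℤ.* ℤ.+ 1) ℤ.* ℤ.+ 1
  eq = cong (ℤ._* ℤ.+ 1) (sym (cong₂ ℤ._+_ (ℤ.*-identityʳ (ℤ.+ m)) (ℤ.*-identityʳ (ℤ.+ n))))

ℕtoℚ-* : ∀ m n → ℕtoℚ (m ℕ.* n) ≡ ℕtoℚ m * ℕtoℚ n
ℕtoℚ-* m n = toℚᵘ-injective (ℚᵘ.≃-trans (toℚᵘ-ℕtoℚ (m ℕ.* n)) (ℚᵘ.≃-trans (ℚᵘ.*≡* eq)
    (ℚᵘ.≃-sym (ℚᵘ.≃-trans (toℚᵘ-homo-* (ℕtoℚ m) (ℕtoℚ n)) (ℚᵘ.*-cong (toℚᵘ-ℕtoℚ m) (toℚᵘ-ℕtoℚ n))))))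
  where
  eq : ℤ.+ (m ℕ.* n) ℤ.* ℤ.+ 1 ≡ (ℤ.+ m ℤ.* ℤ.+ n) ℤ.* ℤ.+ 1
  eq = cong (ℤ._* ℤ.+ 1) (ℤ.pos-* m n)

ℕtoℚ-suc : ∀ n → ℕtoℚ (suc n) ≡ 1ℚ + ℕtoℚ n
ℕtoℚ-suc n = ℕtoℚ-+ 1 n

ℕtoℚ-injective : ∀ {m n} → ℕtoℚ m ≡ ℕtoℚ n → m ≡ n
ℕtoℚ-injective {m} {n} eq
  with ℚᵘ.*≡* eq′ ← ℚᵘ.≃-trans (ℚᵘ.≃-sym (toℚᵘ-ℕtoℚ m)) (ℚᵘ.≃-trans (ℚᵘ.≃-reflexive (cong toℚᵘ eq)) (toℚᵘ-ℕtoℚ n))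
  = ℤ.+-injective (trans (sym (ℤ.*-identityʳ (ℤ.+ m))) (trans eq′ (ℤ.*-identityʳ (ℤ.+ n))))

ℕtoℚ-suc≢0 : ∀ n → ℕtoℚ (suc n) ≢ 0ℚ
ℕtoℚ-suc≢0 n eq with () ← ℕtoℚ-injective {suc n} {0} eq

-≢0 : ∀ {x y} → x ≢ y → x - y ≢ 0ℚ
-≢0 {x} {y} x≢y eq = x≢y (trans (add-back x y) (trans (cong (_+ y) eq) (+-identityˡ y)))
  where
  add-back : ∀ x y → x ≡ x - y + y
  add-back = solve-∀ ℚ-ring

divℕ-inv : ∀ q d → divℕ q d ≡ q * inv (ℕtoℚ d)
divℕ-inv q zero = sym (*-zeroʳ q)
divℕ-inv q (suc d) = cong (q *_) (sym (inv-unique (toℚᵘ-injective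
    (ℚᵘ.≃-trans (toℚᵘ-homo-* ((ℤ.+ 1) / suc d) (ℕtoℚ (suc d)))
    (ℚᵘ.≃-trans (ℚᵘ.*-cong (toℚᵘ-fromℚᵘ (ℚᵘ.mkℚᵘ (ℤ.+ 1) d)) (toℚᵘ-ℕtoℚ (suc d))) (ℚᵘ.*≡* eq))))))
  where
  eq : (ℤ.+ 1 ℤ.* ℤ.+ suc d) ℤ.* ℤ.+ 1 ≡ ℤ.+ 1 ℤ.* ℤ.+ (suc d ℕ.* 1)
  eq = cong ℤ.+_ (trans (ℕ.*-identityʳ _) (cong (1 ℕ.*_) (sym (ℕ.*-identityʳ (suc d)))))

∑ : {A : Set} → List A → (A → ℚ) → ℚ
∑ [] f = 0ℚ
∑ (x ∷ xs) f = f x + ∑ xs f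

module _ {A : Set} where

  ∑-cong : ∀ (xs : List A) {f g : A → ℚ} → (∀ x → f x ≡ g x) → ∑ xs f ≡ ∑ xs g
  ∑-cong [] eq = refl
  ∑-cong (x ∷ xs) eq = cong₂ _+_ (eq x) (∑-cong xs eq)

  ∑-++ : ∀ (xs ys : List A) f → ∑ (xs ++ ys) f ≡ ∑ xs f + ∑ ys f
  ∑-++ [] ys f = sym (+-identityˡ _)
  ∑-++ (x ∷ xs) ys f = trans (cong (f x +_) (∑-++ xs ys f)) (sym (+-assoc (f x) _ _))

  ∑-map : ∀ {B : Set} (h : A → B) xs f → ∑ (map h xs) f ≡ ∑ xs (f ∘ h)
  ∑-map h [] f = refl
  ∑-map h (x ∷ xs) f = cong (f (h x) +_) (∑-map h xs f)

  ∑-zero : ∀ (xs : List A) → ∑ xs (λ _ → 0ℚ) ≡ 0ℚ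
  ∑-zero [] = refl
  ∑-zero (x ∷ xs) = trans (+-identityˡ _) (∑-zero xs)

  ∑-+ : ∀ (xs : List A) f g → ∑ xs (λ x → f x + g x) ≡ ∑ xs f + ∑ xs g
  ∑-+ [] f g = refl
  ∑-+ (x ∷ xs) f g = trans (cong (f x + g x +_) (∑-+ xs f g)) (swap (f x) (g x) (∑ xs f) (∑ xs g))
    where
    swap : ∀ a b c d → a + b + (c + d) ≡ a + c + (b + d)
    swap = solve-∀ ℚ-ring

  ∑-*ˡ : ∀ (xs : List A) c f → ∑ xs (λ x → c * f x) ≡ c * ∑ xs f
  ∑-*ˡ [] c f = sym (*-zeroʳ c)
  ∑-*ˡ (x ∷ xs) c f = trans (cong (c * f x +_) (∑-*ˡ xs c f)) (factor c (f x) (∑ xs f))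
    where
    factor : ∀ c a b → c * a + c * b ≡ c * (a + b)
    factor = solve-∀ ℚ-ring

  ∑-*ʳ : ∀ (xs : List A) c f → ∑ xs (λ x → f x * c) ≡ ∑ xs f * c
  ∑-*ʳ xs c f = trans (∑-cong xs (λ x → *-comm (f x) c)) (trans (∑-*ˡ xs c f) (*-comm c _))

∑-swap : ∀ {A B : Set} (xs : List A) (ys : List B) (f : A → B → ℚ) →
  ∑ xs (λ x → ∑ ys (f x)) ≡ ∑ ys (λ y → ∑ xs (λ x → f x y))
∑-swap [] ys f = sym (∑-zero ys)
∑-swap (x ∷ xs) ys f = trans (cong (∑ ys (f x) +_) (∑-swap xs ys f)) (sym (∑-+ ys (f x) _))

sumℚ-map : ∀ {A : Set} (f : A → ℚ) xs → sumℚ (map f xs) ≡ ∑ xs f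
sumℚ-map f [] = refl
sumℚ-map f (x ∷ xs) = cong (f x +_) (sumℚ-map f xs)

-- Partial fractions

2ℚ : ℚ
2ℚ = 1ℚ + 1ℚ

record Move : Set where
  constructor move
  field
    node residue : ℚ
    target       : List ℕ
open Move

ev : ℚ → List Move → ℚ → ℚ
ev κ ms u = κ + ∑ ms (λ m → residue m * inv (u - node m))

rescale : ℚ → ℚ → (List ℕ → List ℕ) → Move → Move
rescale n d t (move c r ν) = move c (r * ((c - n) * inv (c - d))) (t ν)

-- Partial fraction expansion of ev κ ms u * (u - n) / (u - d).
extend : ℚ → ℚ → ℚ → List ℕ → (List ℕ → List ℕ) → List Move → List Move
extend κ n d h t ms = move d ((d - n) * ev κ ms d) h ∷ map (rescale n d t) ms

moment : List Move → ℕ → ℚ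
moment ms k = ∑ ms (λ m → residue m * powℚ (node m) k)

-- To the ring solver an inverse is a free variable, so each relation `inv x * x ≡ 1ℚ` has to enter
-- as an extra factor.
insert-1 : ∀ x {y} → y ≡ 1ℚ → x ≡ x * y
insert-1 x refl = sym (*-identityʳ x)

inv-swap : ∀ {x y} → x ≢ y → inv (y - x) ≡ - inv (x - y)
inv-swap {x} {y} x≢y = inv-unique (trans (flip x y (inv (x - y))) (inv-* (-≢0 x≢y)))
  where
  flip : ∀ x y i → - i * (y - x) ≡ i * (x - y)
  flip = solve-∀ ℚ-ring

module _ (κ n d : ℚ) (h : List ℕ) (t : List ℕ → List ℕ) where

  -- Additivity in the pole list: the factor splits each `r / (u - c)` into a part at `c` and a part
  -- at `d`, and the parts at `d`, with the one coming from `κ`, add up to the residue of the new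
  -- pole.
  ev-extend : ∀ ms u → u ≢ d → All (λ m → node m ≢ d) ms → All (λ m → u ≢ node m) ms →
    ev κ (extend κ n d h t ms) u ≡ ev κ ms u * ((u - n) * inv (u - d))
  ev-extend ms u u≢d = go ms
    where
    k = inv (u - d)
    k1 : k * (u - d) ≡ 1ℚ
    k1 = inv-* (-≢0 u≢d)
    base : ∀ κ n d u k → κ + ((d - n) * (κ + 0ℚ) * k + 0ℚ) ≡ (κ + 0ℚ) * (d * k - n * k) + κ * 1ℚ
    base = solve-∀ ℚ-ring
    base′ : ∀ κ n d u k → (κ + 0ℚ) * (d * k - n * k) + κ * (k * (u - d)) ≡ (κ + 0ℚ) * ((u - n) * k)
    base′ = solve-∀ ℚ-ring
    term₁ : ∀ n d u k c r i j → r * ((c - n) * i) * j * (k * (u - d)) + (d - n) * (r * - i) * k * (j * (u - c))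
      ≡ r * j * ((u - n) * k) * (i * (c - d))
    term₁ = solve-∀ ℚ-ring
    term : ∀ c r → c ≢ d → u ≢ c →
      r * ((c - n) * inv (c - d)) * inv (u - c) + (d - n) * (r * inv (d - c)) * k ≡ r * inv (u - c) * ((u - n) * k)
    term c r c≢d u≢c = begin
      r * ((c - n) * i) * j + (d - n) * (r * inv (d - c)) * k
        ≡⟨ cong (λ i′ → r * ((c - n) * i) * j + (d - n) * (r * i′) * k) (inv-swap c≢d) ⟩
      r * ((c - n) * i) * j + (d - n) * (r * - i) * k
        ≡⟨ cong₂ _+_ (insert-1 (r * ((c - n) * i) * j) k1) (insert-1 ((d - n) * (r * - i) * k) (inv-* (-≢0 u≢c))) ⟩
      r * ((c - n) * i) * j * (k * (u - d)) + (d - n) * (r * - i) * k * (j * (u - c))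
        ≡⟨ term₁ n d u k c r i j ⟩
      r * j * ((u - n) * k) * (i * (c - d))
        ≡⟨ sym (insert-1 (r * j * ((u - n) * k)) (inv-* (-≢0 c≢d))) ⟩
      r * j * ((u - n) * k) ∎
      where
      i = inv (c - d)
      j = inv (u - c)
    split : ∀ κ e k A B Sa Sb → κ + (e * (κ + (B + Sb)) * k + (A + Sa)) ≡ (κ + (e * (κ + Sb) * k + Sa)) +
        (A + e * B * k)
    split = solve-∀ ℚ-ring
    join : ∀ κ S C v → (κ + S) * v + C * v ≡ (κ + (C + S)) * v
    join = solve-∀ ℚ-ring
    go : ∀ ms → All (λ m → node m ≢ d) ms → All (λ m → u ≢ node m) ms →
      ev κ (extend κ n d h t ms) u ≡ ev κ ms u * ((u - n) * inv (u - d))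
    go [] _ _ = trans (base κ n d u k) (trans (cong (λ z → (κ + 0ℚ) * (d * k - n * k) + κ * z) (sym k1))
        (base′ κ n d u k))
    go (move c r ν ∷ ms) (c≢d ∷ ps) (u≢c ∷ qs) = begin
      κ + ((d - n) * (κ + (B + Sb)) * k + (A + Sa)) ≡⟨ split κ (d - n) k A B Sa Sb ⟩
      (κ + ((d - n) * (κ + Sb) * k + Sa)) + (A + (d - n) * B * k) ≡⟨ cong₂ _+_ (go ms ps qs) (term c r c≢d u≢c) ⟩
      (κ + S) * ((u - n) * k) + C * ((u - n) * k) ≡⟨ join κ S C ((u - n) * k) ⟩
      (κ + (C + S)) * ((u - n) * k) ∎
      where
      B = r * inv (d - c)
      Sb = ∑ ms (λ m → residue m * inv (d - node m))
      A = r * ((c - n) * inv (c - d)) * inv (u - c)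
      Sa = ∑ (map (rescale n d t) ms) (λ m → residue m * inv (u - node m))
      C = r * inv (u - c)
      S = ∑ ms (λ m → residue m * inv (u - node m))

  -- Moment `k` is the coefficient of `u ^ -(k + 1)` of `ev` at infinity, and the expansion of
  -- `(u - n) / (u - d)` begins with `1 + (d - n) / u`.
  moment-extend-zero : ∀ ms → All (λ m → node m ≢ d) ms →
    moment (extend κ n d h t ms) 0 ≡ moment ms 0 + κ * (d - n)
  moment-extend-zero [] [] = base κ (d - n)
    where
    base : ∀ κ e → e * (κ + 0ℚ) * 1ℚ + 0ℚ ≡ 0ℚ + κ * e
    base = solve-∀ ℚ-ring
  moment-extend-zero (move c r ν ∷ ms) (c≢d ∷ ps) = begin
    (d - n) * (κ + (r * inv (d - c) + Sb)) * 1ℚ + (r * ((c - n) * i) * 1ℚ + Sa)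
      ≡⟨ cong (λ i′ → (d - n) * (κ + (r * i′ + Sb)) * 1ℚ + (r * ((c - n) * i) * 1ℚ + Sa)) (inv-swap c≢d) ⟩
    (d - n) * (κ + (r * - i + Sb)) * 1ℚ + (r * ((c - n) * i) * 1ℚ + Sa)
      ≡⟨ split κ n d c r i Sb Sa ⟩
    r * 1ℚ * (i * (c - d)) + ((d - n) * (κ + Sb) * 1ℚ + Sa)
      ≡⟨ cong₂ _+_ (sym (insert-1 (r * 1ℚ) (inv-* (-≢0 c≢d)))) (moment-extend-zero ms ps) ⟩
    r * 1ℚ + (moment ms 0 + κ * (d - n)) ≡⟨ sym (+-assoc (r * 1ℚ) _ _) ⟩
    r * 1ℚ + moment ms 0 + κ * (d - n) ∎
    where
    i = inv (c - d)
    Sb = ∑ ms (λ m → residue m * inv (d - node m))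
    Sa = moment (map (rescale n d t) ms) 0
    split : ∀ κ n d c r i Sb Sa → (d - n) * (κ + (r * - i + Sb)) * 1ℚ + (r * ((c - n) * i) * 1ℚ + Sa)
      ≡ r * 1ℚ * (i * (c - d)) + ((d - n) * (κ + Sb) * 1ℚ + Sa)
    split = solve-∀ ℚ-ring

  -- The coefficient of `u ^ -(k + 1)` when `u - d` times the new function is compared with `u - n`
  -- times the old one; the new pole at `d` drops out on the left.
  moment-extend-suc : ∀ ms k → All (λ m → node m ≢ d) ms →
    moment (extend κ n d h t ms) (suc k) - d * moment (extend κ n d h t ms) k ≡ moment ms (suc k) - n * moment ms k
  moment-extend-suc ms k ps = trans (drop-head ((d - n) * ev κ ms d) d (powℚ d k) _ _) (go ms ps)
    where
    drop-head : ∀ e d p S T → e * (d * p) + S - d * (e * p + T) ≡ S - d * T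
    drop-head = solve-∀ ℚ-ring
    split : ∀ n d c r i p S T → r * ((c - n) * i) * (c * p) + S - d * (r * ((c - n) * i) * p + T)
      ≡ r * (c - n) * p * (i * (c - d)) + (S - d * T)
    split = solve-∀ ℚ-ring
    join : ∀ n c r p S T → r * (c - n) * p + (S - n * T) ≡ r * (c * p) + S - n * (r * p + T)
    join = solve-∀ ℚ-ring
    go : ∀ ms → All (λ m → node m ≢ d) ms →
      moment (map (rescale n d t) ms) (suc k) - d * moment (map (rescale n d t) ms) k ≡ moment ms
          (suc k) - n * moment ms k
    go [] [] = base n d
      where
      base : ∀ n d → 0ℚ - d * 0ℚ ≡ 0ℚ - n * 0ℚ
      base = solve-∀ ℚ-ring
    go (move c r ν ∷ ms) (c≢d ∷ ps) = begin
      _ ≡⟨ split n d c r (inv (c - d)) (powℚ c k) _ _ ⟩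
      r * (c - n) * powℚ c k * (inv (c - d) * (c - d)) +
          (moment (map (rescale n d t) ms) (suc k) - d * moment (map (rescale n d t) ms) k)
        ≡⟨ cong₂ _+_ (sym (insert-1 (r * (c - n) * powℚ c k) (inv-* (-≢0 c≢d)))) (go ms ps) ⟩
      r * (c - n) * powℚ c k + (moment ms (suc k) - n * moment ms k) ≡⟨ join n c r (powℚ c k) _ _ ⟩
      _ ∎

-- Adding and removing a box

-- The inductions put a new largest row on top; the bound in the index separates its node from all
-- nodes below it.
data StrictBelow : ℕ → List ℕ → Set where
  []   : ∀ {b} → StrictBelow b []
  cons : ∀ {b y λ′} → 0 < y → y < b → StrictBelow y λ′ → StrictBelow b (y ∷ λ′)

weaken : ∀ {b c λ′} → b ≤ c → StrictBelow b λ′ → StrictBelow c λ′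
weaken b≤c [] = []
weaken b≤c (cons 0<y y<b s) = cons 0<y (ℕ.≤-trans y<b b≤c) s

-- Content of the box added to, resp. removed from, a row of length y.
α β : ℕ → ℚ
α y = ℕtoℚ y * (1ℚ + ℕtoℚ y)
β y = ℕtoℚ y * (ℕtoℚ y - 1ℚ)

β-suc : ∀ y → β (suc y) ≡ α y
β-suc y = trans (cong (λ q → q * (q - 1ℚ)) (ℕtoℚ-suc y)) (eq (ℕtoℚ y))
  where
  eq : ∀ q → (1ℚ + q) * (1ℚ + q - 1ℚ) ≡ q * (1ℚ + q)
  eq = solve-∀ ℚ-ring

α≢ : ∀ {x y} → x < y → α x ≢ α y
α≢ {x} {y} x<y eq = ℕ.<⇒≢ (ℕ.*-mono-< x<y (s≤s x<y)) (ℕtoℚ-injective (trans (αℕ x) (trans eq (sym (αℕ y)))))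
  where
  αℕ : ∀ x → ℕtoℚ (x ℕ.* suc x) ≡ α x
  αℕ x = trans (ℕtoℚ-* x (suc x)) (cong (ℕtoℚ x *_) (ℕtoℚ-suc x))

β≢ : ∀ {x y} → 0 < x → x < y → β x ≢ β y
β≢ {suc x} {suc y} _ (s≤s x<y) eq = α≢ x<y (trans (sym (β-suc x)) (trans eq (β-suc y)))

-- The value of lower at 0 is junk.
lower : ℕ → List ℕ → List ℕ
lower zero λ′ = λ′
lower (suc zero) λ′ = λ′
lower (suc (suc y)) λ′ = suc y ∷ λ′

-- The poles and residues of u⁻¹ ∏ (u - β z) / (u - α z) for up and of ∏ (u - α z) / (u - β z) for down, each
-- with the result of the corresponding box move. Targets that are not strict partitions have W = 0.
up down : List ℕ → List Move
up [] = move 0ℚ 1ℚ (1 ∷ []) ∷ []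
up (y ∷ λ′) = extend 0ℚ (β y) (α y) (suc y ∷ λ′) (y ∷_) (up λ′)
down [] = []
down (y ∷ λ′) = extend 1ℚ (α y) (β y) (lower y λ′) (y ∷_) (down λ′)

up-nodes : ∀ {b λ′} → 0 < b → StrictBelow b λ′ → All (λ m → ∃ λ z → z < b × node m ≡ α z) (up λ′)
up-nodes 0<b [] = (0 , 0<b , refl) ∷ []
up-nodes 0<b (cons {y = y} 0<y y<b s) = (y , y<b , refl) ∷
  All.map⁺ (All.map (λ (z , z<y , eq) → z , ℕ.<-trans z<y y<b , eq) (up-nodes 0<y s))

down-nodes : ∀ {b λ′} → StrictBelow b λ′ → All (λ m → ∃ λ z → 0 < z × z < b × node m ≡ β z) (down λ′)
down-nodes [] = []
down-nodes (cons {y = y} 0<y y<b s) = (y , 0<y , y<b , refl) ∷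
  All.map⁺ (All.map (λ (z , 0<z , z<y , eq) → z , 0<z , ℕ.<-trans z<y y<b , eq) (down-nodes s))

up-nodes≢ : ∀ {b y λ′} → 0 < b → b ≤ y → StrictBelow b λ′ → All (λ m → node m ≢ α y) (up λ′)
up-nodes≢ 0<b b≤y s = All.map (λ (z , z<b , eq) eq′ → α≢ (ℕ.<-≤-trans z<b b≤y) (trans (sym eq) eq′)) (up-nodes 0<b s)

down-nodes≢ : ∀ {b y λ′} → b ≤ y → StrictBelow b λ′ → All (λ m → node m ≢ β y) (down λ′)
down-nodes≢ b≤y s = All.map (λ (z , 0<z , z<b , eq) eq′ → β≢ 0<z (ℕ.<-≤-trans z<b b≤y) (trans (sym eq) eq′))
    (down-nodes s)

-- The product of `(y - z) / (y + z)` over the rows `z`, as in Schur's product formula; it vanishes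
-- when `y` itself occurs among them.
R : ℕ → List ℕ → ℚ
R y [] = 1ℚ
R y (z ∷ λ′) = (ℕtoℚ y - ℕtoℚ z) * inv (ℕtoℚ y + ℕtoℚ z) * R y λ′

-- The shifted hook formula says g λ = |λ|! W λ.
W : List ℕ → ℚ
W [] = 1ℚ
W (y ∷ λ′) = W λ′ * inv (ℕtoℚ (y !)) * R y λ′

-- `W` together with the factor `2 ^ -ℓ(λ)` of the expectation; with it the residues of `Φ` become
-- ratios of weights.
V : List ℕ → ℚ
V λ′ = W λ′ * inv (ℕtoℚ (2 ℕ.^ length λ′))

+≢0 : ∀ {y} z → 0 < y → ℕtoℚ y + ℕtoℚ z ≢ 0ℚ
+≢0 {suc y} z _ eq = ℕtoℚ-suc≢0 (y ℕ.+ z) (trans (ℕtoℚ-+ (suc y) z) eq)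

-≢0′ : ∀ {x y} → x < y → ℕtoℚ y - ℕtoℚ x ≢ 0ℚ
-≢0′ x<y = -≢0 (λ eq → ℕ.<⇒≢ x<y (sym (ℕtoℚ-injective eq)))

-- The common shape of the four ways in which a factor of `R` changes: `α x - β z` and `α x - α z`
-- split into two linear forms each, and two of the four cancel against the old factor.
cross-cancel : ∀ A B C D → B ≢ 0ℚ → C ≢ 0ℚ → D ≢ 0ℚ →
  A * B * inv (C * D) * (C * inv B) ≡ A * inv D
cross-cancel A B C D B≢0 C≢0 D≢0 = begin
  A * B * inv (C * D) * (C * inv B)      ≡⟨ cong (λ k → A * B * k * (C * inv B)) (inv-distrib-* C D) ⟩
  A * B * (inv C * inv D) * (C * inv B)  ≡⟨ rearrange A B C (inv C) (inv D) (inv B) ⟩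
  A * inv D * (inv B * B) * (inv C * C)  ≡⟨ cong₂ (λ p q → A * inv D * p * q) (inv-* B≢0) (inv-* C≢0) ⟩
  A * inv D * 1ℚ * 1ℚ                    ≡⟨ trans (*-identityʳ _) (*-identityʳ _) ⟩
  A * inv D ∎
  where
  rearrange : ∀ A B C c d b → A * B * (c * d) * (C * b) ≡ A * d * (b * B) * (c * C)
  rearrange = solve-∀ ℚ-ring

α-β : ∀ x z → α x - β z ≡ (1ℚ + ℕtoℚ x - ℕtoℚ z) * (ℕtoℚ x + ℕtoℚ z)
α-β x z = eq (ℕtoℚ x) (ℕtoℚ z)
  where
  eq : ∀ x z → x * (1ℚ + x) - z * (z - 1ℚ) ≡ (1ℚ + x - z) * (x + z)
  eq = solve-∀ ℚ-ring

α-α : ∀ x z → α x - α z ≡ (ℕtoℚ x - ℕtoℚ z) * (1ℚ + ℕtoℚ x + ℕtoℚ z)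
α-α x z = eq (ℕtoℚ x) (ℕtoℚ z)
  where
  eq : ∀ x z → x * (1ℚ + x) - z * (1ℚ + z) ≡ (x - z) * (1ℚ + x + z)
  eq = solve-∀ ℚ-ring

-- The factor of a row z in R (suc y) λ / R y λ.
R-step-factor : ∀ {y z} → 0 < y → z < y →
  (α y - β z) * inv (α y - α z) * ((ℕtoℚ y - ℕtoℚ z) * inv (ℕtoℚ y + ℕtoℚ z))
  ≡ (ℕtoℚ (suc y) - ℕtoℚ z) * inv (ℕtoℚ (suc y) + ℕtoℚ z)
R-step-factor {y} {z} 0<y z<y = begin
  (α y - β z) * inv (α y - α z) * (C * inv B)
    ≡⟨ cong₂ (λ p q → p * inv q * (C * inv B)) (α-β y z) (α-α y z) ⟩
  (1ℚ + ℕtoℚ y - ℕtoℚ z) * B * inv (C * (1ℚ + ℕtoℚ y + ℕtoℚ z)) * (C * inv B)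
    ≡⟨ cong (λ s → (s - ℕtoℚ z) * B * inv (C * (s + ℕtoℚ z)) * (C * inv B)) (sym (ℕtoℚ-suc y)) ⟩
  (ℕtoℚ (suc y) - ℕtoℚ z) * B * inv (C * (ℕtoℚ (suc y) + ℕtoℚ z)) * (C * inv B)
    ≡⟨ cross-cancel (ℕtoℚ (suc y) - ℕtoℚ z) B C (ℕtoℚ (suc y) + ℕtoℚ z) (+≢0 z 0<y) (-≢0′ z<y) (+≢0 z (ℕ.z<s {y})) ⟩
  _ ∎
  where
  B = ℕtoℚ y + ℕtoℚ z
  C = ℕtoℚ y - ℕtoℚ z

R-unstep-factor : ∀ {y z} → 0 < z → z < suc y →
  (β (suc y) - α z) * inv (β (suc y) - β z) * ((ℕtoℚ (suc y) - ℕtoℚ z) * inv (ℕtoℚ (suc y) + ℕtoℚ z))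
  ≡ (ℕtoℚ y - ℕtoℚ z) * inv (ℕtoℚ y + ℕtoℚ z)
R-unstep-factor {y} {z} 0<z z<y = begin
  (β (suc y) - α z) * inv (β (suc y) - β z) * (C * inv B)
    ≡⟨ cong (λ p → (p - α z) * inv (p - β z) * (C * inv B)) (β-suc y) ⟩
  (α y - α z) * inv (α y - β z) * (C * inv B)
    ≡⟨ cong₂ (λ p q → p * inv q * (C * inv B)) (α-α y z) (α-β y z) ⟩
  A * (1ℚ + ℕtoℚ y + ℕtoℚ z) * inv ((1ℚ + ℕtoℚ y - ℕtoℚ z) * D) * (C * inv B)
    ≡⟨ cong (λ s → A * (s + ℕtoℚ z) * inv ((s - ℕtoℚ z) * D) * (C * inv B)) (sym (ℕtoℚ-suc y)) ⟩
  A * B * inv (C * D) * (C * inv B)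
    ≡⟨ cross-cancel A B C D (+≢0 z (ℕ.z<s {y})) (-≢0′ z<y) (subst (_≢ 0ℚ) (+-comm (ℕtoℚ z) (ℕtoℚ y)) (+≢0 y 0<z)) ⟩
  _ ∎
  where
  A = ℕtoℚ y - ℕtoℚ z
  B = ℕtoℚ (suc y) + ℕtoℚ z
  C = ℕtoℚ (suc y) - ℕtoℚ z
  D = ℕtoℚ y + ℕtoℚ z

-- At `u = α y` the product `Φ` collapses row by row into a quotient of two values of `R`; the extra
-- `α y` compensates the factor `u⁻¹` of `Φ`.
ev-up : ∀ {b y λ′} → 0 < y → b ≤ y → StrictBelow b λ′ →
  ev 0ℚ (up λ′) (α y) * (α y * R y λ′) ≡ R (suc y) λ′
ev-up {y = y} 0<y _ [] = trans (rearrange (inv (α y - 0ℚ)) (α y)) (inv-* (-≢0 (λ eq → α≢ 0<y (sym eq))))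
  where
  rearrange : ∀ i a → (0ℚ + (1ℚ * i + 0ℚ)) * (a * 1ℚ) ≡ i * (a - 0ℚ)
  rearrange = solve-∀ ℚ-ring
ev-up {y = y} 0<y b≤y (cons {y = z} {λ′} 0<z z<b s) = begin
  ev 0ℚ (up (z ∷ λ′)) (α y) * (α y * (f * R y λ′))
    ≡⟨ cong (_* (α y * (f * R y λ′))) (ev-extend 0ℚ (β z) (α z) (suc z ∷ λ′) (z ∷_) (up λ′) (α y)
         (≢-sym (α≢ z<y)) (up-nodes≢ 0<z ℕ.≤-refl s) (All.map ≢-sym (up-nodes≢ 0<z (ℕ.<⇒≤ z<y) s))) ⟩
  ev 0ℚ (up λ′) (α y) * w * (α y * (f * R y λ′))
    ≡⟨ rearrange (ev 0ℚ (up λ′) (α y)) w (α y) f (R y λ′) ⟩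
  w * f * (ev 0ℚ (up λ′) (α y) * (α y * R y λ′))
    ≡⟨ cong₂ _*_ (R-step-factor 0<y z<y) (ev-up 0<y (ℕ.<⇒≤ z<y) s) ⟩
  _ ∎
  where
  z<y = ℕ.<-≤-trans z<b b≤y
  f = (ℕtoℚ y - ℕtoℚ z) * inv (ℕtoℚ y + ℕtoℚ z)
  w = (α y - β z) * inv (α y - α z)
  rearrange : ∀ e w a f r → e * w * (a * (f * r)) ≡ w * f * (e * (a * r))
  rearrange = solve-∀ ℚ-ring

-- The same collapse at `β (suc y)`, which is `α y`; there is no factor `u⁻¹` here, hence no
-- prefactor.
ev-down : ∀ {b y λ′} → b ≤ suc y → StrictBelow b λ′ →
  ev 1ℚ (down λ′) (β (suc y)) * R (suc y) λ′ ≡ R y λ′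
ev-down _ [] = refl
ev-down {y = y} b≤y (cons {y = z} {λ′} 0<z z<b s) = begin
  ev 1ℚ (down (z ∷ λ′)) (β (suc y)) * (f * R (suc y) λ′)
    ≡⟨ cong (_* (f * R (suc y) λ′)) (ev-extend 1ℚ (α z) (β z) (lower z λ′) (z ∷_) (down λ′) (β (suc y))
         (≢-sym (β≢ 0<z z<y)) (down-nodes≢ ℕ.≤-refl s) (All.map ≢-sym (down-nodes≢ (ℕ.<⇒≤ z<y) s))) ⟩
  ev 1ℚ (down λ′) (β (suc y)) * w * (f * R (suc y) λ′)
    ≡⟨ rearrange (ev 1ℚ (down λ′) (β (suc y))) w f (R (suc y) λ′) ⟩
  w * f * (ev 1ℚ (down λ′) (β (suc y)) * R (suc y) λ′)
    ≡⟨ cong₂ _*_ (R-unstep-factor 0<z z<y) (ev-down (ℕ.<⇒≤ z<y) s) ⟩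
  _ ∎
  where
  z<y = ℕ.<-≤-trans z<b b≤y
  f = (ℕtoℚ (suc y) - ℕtoℚ z) * inv (ℕtoℚ (suc y) + ℕtoℚ z)
  w = (β (suc y) - α z) * inv (β (suc y) - β z)
  rearrange : ∀ e w f r → e * w * (f * r) ≡ w * f * (e * r)
  rearrange = solve-∀ ℚ-ring

-- The right factor is the one introduced by rescale at the node α z.
R-grow-factor : ∀ {y z} → z < y →
  (ℕtoℚ y - ℕtoℚ (suc z)) * inv (ℕtoℚ y + ℕtoℚ (suc z))
  ≡ (ℕtoℚ y - ℕtoℚ z) * inv (ℕtoℚ y + ℕtoℚ z) * ((α z - β y) * inv (α z - α y))
R-grow-factor {y} {z} z<y = begin
  (Y - S) * inv (Y + S)
    ≡⟨ trans (flip₁ Y S (inv (Y + S))) (cong (λ d → - ((S - Y) * inv d)) (+-comm Y S)) ⟩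
  - ((S - Y) * inv (S + Y))
    ≡⟨ cong -_ (sym (cross-cancel (S - Y) (Z + Y) (Z - Y) (S + Y) Z+Y≢0 (-≢0 Z≢Y) S+Y≢0)) ⟩
  - ((S - Y) * (Z + Y) * inv ((Z - Y) * (S + Y)) * ((Z - Y) * inv (Z + Y)))
    ≡⟨ cong (λ s → - ((s - Y) * (Z + Y) * inv ((Z - Y) * (s + Y)) * ((Z - Y) * inv (Z + Y)))) (ℕtoℚ-suc z) ⟩
  - ((1ℚ + Z - Y) * (Z + Y) * inv ((Z - Y) * (1ℚ + Z + Y)) * ((Z - Y) * inv (Z + Y)))
    ≡⟨ cong₂ (λ p q → - (p * inv q * ((Z - Y) * inv (Z + Y)))) (sym (α-β z y)) (sym (α-α z y)) ⟩
  - ((α z - β y) * inv (α z - α y) * ((Z - Y) * inv (Z + Y)))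
    ≡⟨ cong (λ d → - ((α z - β y) * inv (α z - α y) * ((Z - Y) * inv d))) (+-comm Z Y) ⟩
  - ((α z - β y) * inv (α z - α y) * ((Z - Y) * inv (Y + Z)))
    ≡⟨ flip₂ Y Z (inv (Y + Z)) ((α z - β y) * inv (α z - α y)) ⟩
  _ ∎
  where
  Y = ℕtoℚ y
  Z = ℕtoℚ z
  S = ℕtoℚ (suc z)
  flip₁ : ∀ y s i → (y - s) * i ≡ - ((s - y) * i)
  flip₁ = solve-∀ ℚ-ring
  flip₂ : ∀ y z i w → - (w * ((z - y) * i)) ≡ (y - z) * i * w
  flip₂ = solve-∀ ℚ-ring
  Z≢Y : Z ≢ Y
  Z≢Y eq = ℕ.<⇒≢ z<y (ℕtoℚ-injective eq)
  Z+Y≢0 : Z + Y ≢ 0ℚ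
  Z+Y≢0 = subst (_≢ 0ℚ) (+-comm Y Z) (+≢0 z (ℕ.≤-<-trans z≤n z<y))
  S+Y≢0 : S + Y ≢ 0ℚ
  S+Y≢0 = +≢0 y (ℕ.z<s {z})

R-shrink-factor : ∀ {y z} → suc z < y →
  (ℕtoℚ y - ℕtoℚ z) * inv (ℕtoℚ y + ℕtoℚ z)
  ≡ (ℕtoℚ y - ℕtoℚ (suc z)) * inv (ℕtoℚ y + ℕtoℚ (suc z)) * ((β (suc z) - α y) * inv (β (suc z) - β y))
R-shrink-factor {y} {z} z<y = begin
  (Y - Z) * inv (Y + Z)
    ≡⟨ trans (flip₁ Y Z (inv (Y + Z))) (cong (λ d → - ((Z - Y) * inv d)) (+-comm Y Z)) ⟩
  - ((Z - Y) * inv (Z + Y))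
    ≡⟨ cong -_ (sym (cross-cancel (Z - Y) (S + Y) (S - Y) (Z + Y) S+Y≢0 (-≢0 S≢Y) Z+Y≢0)) ⟩
  - ((Z - Y) * (S + Y) * inv ((S - Y) * (Z + Y)) * ((S - Y) * inv (S + Y)))
    ≡⟨ cong (λ s → - ((Z - Y) * (s + Y) * inv ((s - Y) * (Z + Y)) * ((S - Y) * inv (S + Y)))) (ℕtoℚ-suc z) ⟩
  - ((Z - Y) * (1ℚ + Z + Y) * inv ((1ℚ + Z - Y) * (Z + Y)) * ((S - Y) * inv (S + Y)))
    ≡⟨ cong₂ (λ p q → - (p * inv q * ((S - Y) * inv (S + Y)))) (sym (α-α z y)) (sym (α-β z y)) ⟩
  - ((α z - α y) * inv (α z - β y) * ((S - Y) * inv (S + Y)))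
    ≡⟨ cong₂ (λ a d → - ((a - α y) * inv (a - β y) * ((S - Y) * inv d))) (sym (β-suc z)) (+-comm S Y) ⟩
  - ((β (suc z) - α y) * inv (β (suc z) - β y) * ((S - Y) * inv (Y + S)))
    ≡⟨ flip₂ Y S (inv (Y + S)) ((β (suc z) - α y) * inv (β (suc z) - β y)) ⟩
  _ ∎
  where
  Y = ℕtoℚ y
  Z = ℕtoℚ z
  S = ℕtoℚ (suc z)
  flip₁ : ∀ y s i → (y - s) * i ≡ - ((s - y) * i)
  flip₁ = solve-∀ ℚ-ring
  flip₂ : ∀ y z i w → - (w * ((z - y) * i)) ≡ (y - z) * i * w
  flip₂ = solve-∀ ℚ-ring
  S≢Y : S ≢ Y
  S≢Y eq = ℕ.<⇒≢ z<y (ℕtoℚ-injective eq)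
  Z+Y≢0 : Z + Y ≢ 0ℚ
  Z+Y≢0 = subst (_≢ 0ℚ) (+-comm Y Z) (+≢0 z (ℕ.≤-<-trans z≤n z<y))
  S+Y≢0 : S + Y ≢ 0ℚ
  S+Y≢0 = +≢0 y (ℕ.z<s {z})

private
  swap-last : ∀ f w r → f * w * r ≡ f * r * w
  swap-last = solve-∀ ℚ-ring

R-zero : ∀ {y} → 0 < y → (ℕtoℚ y - ℕtoℚ 0) * inv (ℕtoℚ y + ℕtoℚ 0) ≡ 1ℚ
R-zero {y} 0<y = trans (cong (_* inv (ℕtoℚ y + 0ℚ)) (shift (ℕtoℚ y)))
    (trans (*-comm (ℕtoℚ y + 0ℚ) _) (inv-* (+≢0 0 0<y)))
  where
  shift : ∀ q → q - 0ℚ ≡ q + 0ℚ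
  shift = solve-∀ ℚ-ring

-- A move in the lower rows changes `R y` by exactly the factor that `rescale` puts on its residue
-- when row `y` is added. This makes the induction for `V-up` close.
R-up : ∀ {b y λ′} → 0 < y → b ≤ y → StrictBelow b λ′ →
  All (λ m → R y (target m) ≡ R y λ′ * ((node m - β y) * inv (node m - α y))) (up λ′)
-- By `R-zero` a phantom row of length 0 contributes the factor 1, so opening a row is the case
-- `z = 0` of growing a row.
R-up {y = y} 0<y _ [] = trans (*-identityʳ _) (trans (R-grow-factor {y} {0} 0<y)
  (cong (λ p → p * ((α 0 - β y) * inv (α 0 - α y))) (R-zero 0<y))) ∷ []
R-up {y = y} 0<y b≤y (cons {y = z} {λ′} 0<z z<b s) =
  trans (cong (_* R y λ′) (R-grow-factor z<y))
    (swap-last ((ℕtoℚ y - ℕtoℚ z) * inv (ℕtoℚ y + ℕtoℚ z)) _ (R y λ′))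
  ∷ All.map⁺ (All.map (λ {m} → tail m) (R-up 0<y (ℕ.<⇒≤ z<y) s))
  where
  z<y = ℕ.<-≤-trans z<b b≤y
  f = (ℕtoℚ y - ℕtoℚ z) * inv (ℕtoℚ y + ℕtoℚ z)
  tail : ∀ m → R y (target m) ≡ R y λ′ * ((node m - β y) * inv (node m - α y)) →
    f * R y (target m) ≡ f * R y λ′ * ((node m - β y) * inv (node m - α y))
  tail m eq = trans (cong (f *_) eq) (sym (*-assoc f (R y λ′) _))

-- A row of length 1 in a strict partition is the last one. `lower` drops it when its box is
-- removed, and a phantom row of length 0 would have contributed the factor 1.
R-lower : ∀ {y z λ′} → 0 < y → StrictBelow (suc z) λ′ → R y (lower (suc z) λ′) ≡ R y (z ∷ λ′)
R-lower {z = suc z} _ _ = refl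
R-lower {z = zero} 0<y [] = sym (trans (*-identityʳ _) (R-zero 0<y))
R-lower {z = zero} 0<y (cons {y = suc _} _ (s≤s ()) _)

W-lower : ∀ {z λ′} → StrictBelow (suc z) λ′ → W (lower (suc z) λ′) ≡ W (z ∷ λ′)
W-lower {suc z} _ = refl
W-lower {zero} [] = refl
W-lower {zero} (cons {y = suc _} _ (s≤s ()) _)

R-down : ∀ {b y λ′} → b ≤ y → StrictBelow b λ′ →
  All (λ m → R y (target m) ≡ R y λ′ * ((node m - α y) * inv (node m - β y))) (down λ′)
R-down _ [] = []
R-down {y = y} b≤y (cons {y = suc z} {λ′} 0<z z<b s) =
  trans (R-lower (ℕ.<-trans 0<z z<y) s) (trans (cong (_* R y λ′) (R-shrink-factor z<y))
    (swap-last ((ℕtoℚ y - ℕtoℚ (suc z)) * inv (ℕtoℚ y + ℕtoℚ (suc z))) _ (R y λ′)))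
  ∷ All.map⁺ (All.map (λ {m} → tail m) (R-down (ℕ.<⇒≤ z<y) s))
  where
  z<y = ℕ.<-≤-trans z<b b≤y
  f = (ℕtoℚ y - ℕtoℚ (suc z)) * inv (ℕtoℚ y + ℕtoℚ (suc z))
  tail : ∀ m → R y (target m) ≡ R y λ′ * ((node m - α y) * inv (node m - β y)) →
    f * R y (target m) ≡ f * R y λ′ * ((node m - α y) * inv (node m - β y))
  tail m eq = trans (cong (f *_) eq) (sym (*-assoc f (R y λ′) _))

inv-! : ∀ y → inv (ℕtoℚ (suc y !)) ≡ inv (ℕtoℚ (suc y)) * inv (ℕtoℚ (y !))
inv-! y = trans (cong inv (ℕtoℚ-* (suc y) (y !))) (inv-distrib-* (ℕtoℚ (suc y)) (ℕtoℚ (y !)))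

inv-2^ : ∀ n → inv (ℕtoℚ (2 ℕ.^ suc n)) ≡ ½ * inv (ℕtoℚ (2 ℕ.^ n))
inv-2^ n = trans (cong inv (ℕtoℚ-* 2 (2 ℕ.^ n))) (inv-distrib-* 2ℚ (ℕtoℚ (2 ℕ.^ n)))

V-cons : ∀ y λ′ → V (y ∷ λ′) ≡ V λ′ * (½ * inv (ℕtoℚ (y !)) * R y λ′)
V-cons y λ′ = trans (cong (W (y ∷ λ′) *_) (inv-2^ (length λ′)))
  (rearrange (W λ′) (inv (ℕtoℚ (y !))) (R y λ′) (inv (ℕtoℚ (2 ℕ.^ length λ′))) ½)
  where
  rearrange : ∀ w i r h h′ → w * i * r * (h′ * h) ≡ w * h * (h′ * i * r)
  rearrange = solve-∀ ℚ-ring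

-- For the top row this is `ev-up` together with `α y - β y = 2 y` and the change of the factorial;
-- for the other rows both sides acquire the same factor by `R-up`. Non-strict targets are included:
-- both sides are then 0.
V-up : ∀ {b λ′} → StrictBelow b λ′ → All (λ m → 2ℚ * V (target m) ≡ residue m * V λ′) (up λ′)
V-up [] = refl ∷ []
V-up (cons {y = y} {λ′} 0<y _ s) = head ∷ All.map⁺ (All.zipWith (λ {m} → tail m) (R-up 0<y ℕ.≤-refl s , V-up s))
  where
  e = ev 0ℚ (up λ′) (α y)
  i = inv (ℕtoℚ (y !))
  i′ = inv (ℕtoℚ (suc y))
  q = ℕtoℚ y
  rearrange₁ : ∀ v h i i′ e q r s → 2ℚ * (v * (h * (i′ * i) * (e * (q * s * r)))) ≡ 2ℚ *
      (v * (h * i * (e * (q * r)))) * (i′ * s)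
  rearrange₁ = solve-∀ ℚ-ring
  rearrange₂ : ∀ v h i e q r → 2ℚ * (v * (h * i * (e * (q * r)))) ≡ (q * (1ℚ + q) - q * (q - 1ℚ)) * e *
      (v * (h * i * r))
  rearrange₂ = solve-∀ ℚ-ring
  head : 2ℚ * V (suc y ∷ λ′) ≡ (α y - β y) * e * V (y ∷ λ′)
  head = begin
    2ℚ * V (suc y ∷ λ′) ≡⟨ cong (2ℚ *_) (V-cons (suc y) λ′) ⟩
    2ℚ * (V λ′ * (½ * inv (ℕtoℚ (suc y !)) * R (suc y) λ′))
      ≡⟨ cong₂ (λ j r → 2ℚ * (V λ′ * (½ * j * r))) (inv-! y) (sym (ev-up 0<y ℕ.≤-refl s)) ⟩
    2ℚ * (V λ′ * (½ * (i′ * i) * (e * (α y * R y λ′)))) ≡⟨ rearrange₁ (V λ′) ½ i i′ e q (R y λ′) (1ℚ + q) ⟩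
    2ℚ * (V λ′ * (½ * i * (e * (q * R y λ′)))) * (i′ * (1ℚ + q))
      ≡⟨ sym (insert-1 _ (trans (cong (i′ *_) (sym (ℕtoℚ-suc y))) (inv-* (ℕtoℚ-suc≢0 y)))) ⟩
    2ℚ * (V λ′ * (½ * i * (e * (q * R y λ′)))) ≡⟨ rearrange₂ (V λ′) ½ i e q (R y λ′) ⟩
    (α y - β y) * e * (V λ′ * (½ * i * R y λ′)) ≡⟨ cong ((α y - β y) * e *_) (sym (V-cons y λ′)) ⟩
    (α y - β y) * e * V (y ∷ λ′) ∎
  rearrange₃ : ∀ t v h r w → t * (v * (h * (r * w))) ≡ t * v * (h * r * w)
  rearrange₃ = solve-∀ ℚ-ring
  rearrange₄ : ∀ c v h r w → c * v * (h * r * w) ≡ c * w * (v * (h * r))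
  rearrange₄ = solve-∀ ℚ-ring
  tail : ∀ m → R y (target m) ≡ R y λ′ * ((node m - β y) * inv (node m - α y))
    × 2ℚ * V (target m) ≡ residue m * V λ′ →
    2ℚ * V (y ∷ target m) ≡ residue m * ((node m - β y) * inv (node m - α y)) * V (y ∷ λ′)
  tail m (eqR , eqV) = begin
    2ℚ * V (y ∷ target m) ≡⟨ cong (2ℚ *_) (V-cons y (target m)) ⟩
    2ℚ * (V (target m) * (½ * i * R y (target m))) ≡⟨ cong (λ r → 2ℚ * (V (target m) * (½ * i * r))) eqR ⟩
    2ℚ * (V (target m) * (½ * i * (R y λ′ * w))) ≡⟨ rearrange₃ 2ℚ (V (target m)) (½ * i) (R y λ′) w ⟩
    2ℚ * V (target m) * (½ * i * R y λ′ * w) ≡⟨ cong (_* (½ * i * R y λ′ * w)) eqV ⟩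
    residue m * V λ′ * (½ * i * R y λ′ * w) ≡⟨ rearrange₄ (residue m) (V λ′) (½ * i) (R y λ′) w ⟩
    residue m * w * (V λ′ * (½ * i * R y λ′)) ≡⟨ cong (residue m * w *_) (sym (V-cons y λ′)) ⟩
    residue m * w * V (y ∷ λ′) ∎
    where w = (node m - β y) * inv (node m - α y)

-- The counterpart of `V-up` for removals; the sign comes from `β y - α y = - 2 y`.
W-down : ∀ {b λ′} → StrictBelow b λ′ → All (λ m → - (2ℚ * W (target m)) ≡ residue m * W λ′) (down λ′)
W-down [] = []
W-down (cons {y = suc y} {λ′} 0<y _ s) = head ∷ All.map⁺ (All.zipWith (λ {m} → tail m) (R-down ℕ.≤-refl s , W-down s))
  where
  e = ev 1ℚ (down λ′) (β (suc y))
  i = inv (ℕtoℚ (y !))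
  i′ = inv (ℕtoℚ (suc y))
  q = ℕtoℚ (suc y)
  rearrange : ∀ w i i′ e q r → - (2ℚ * (w * i * (e * r))) * (i′ * q) ≡ (q * (q - 1ℚ) - q * (1ℚ + q)) * e *
      (w * (i′ * i) * r)
  rearrange = solve-∀ ℚ-ring
  head : - (2ℚ * W (lower (suc y) λ′)) ≡ (β (suc y) - α (suc y)) * e * W (suc y ∷ λ′)
  head = begin
    - (2ℚ * W (lower (suc y) λ′)) ≡⟨ cong (λ w → - (2ℚ * w)) (W-lower s) ⟩
    - (2ℚ * (W λ′ * i * R y λ′)) ≡⟨ cong (λ r → - (2ℚ * (W λ′ * i * r))) (sym (ev-down ℕ.≤-refl s)) ⟩
    - (2ℚ * (W λ′ * i * (e * R (suc y) λ′))) ≡⟨ insert-1 _ (inv-* (ℕtoℚ-suc≢0 y)) ⟩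
    - (2ℚ * (W λ′ * i * (e * R (suc y) λ′))) * (i′ * q) ≡⟨ rearrange (W λ′) i i′ e q (R (suc y) λ′) ⟩
    (β (suc y) - α (suc y)) * e * (W λ′ * (i′ * i) * R (suc y) λ′)
      ≡⟨ cong (λ j → (β (suc y) - α (suc y)) * e * (W λ′ * j * R (suc y) λ′)) (sym (inv-! y)) ⟩
    (β (suc y) - α (suc y)) * e * W (suc y ∷ λ′) ∎
  j = inv (ℕtoℚ (suc y !))
  rearrange₃ : ∀ v h r w → - (2ℚ * (v * h * (r * w))) ≡ - (2ℚ * v) * (h * r * w)
  rearrange₃ = solve-∀ ℚ-ring
  rearrange₄ : ∀ c v h r w → c * v * (h * r * w) ≡ c * w * (v * h * r)
  rearrange₄ = solve-∀ ℚ-ring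
  tail : ∀ m → R (suc y) (target m) ≡ R (suc y) λ′ * ((node m - α (suc y)) * inv (node m - β (suc y)))
      × - (2ℚ * W (target m)) ≡ residue m * W λ′ →
    - (2ℚ * W (suc y ∷ target m)) ≡ residue m * ((node m - α (suc y)) * inv (node m - β (suc y))) * W (suc y ∷ λ′)
  tail m (eqR , eqW) = begin
    - (2ℚ * (W (target m) * j * R (suc y) (target m))) ≡⟨ cong (λ r → - (2ℚ * (W (target m) * j * r))) eqR ⟩
    - (2ℚ * (W (target m) * j * (R (suc y) λ′ * w))) ≡⟨ rearrange₃ (W (target m)) j (R (suc y) λ′) w ⟩
    - (2ℚ * W (target m)) * (j * R (suc y) λ′ * w) ≡⟨ cong (_* (j * R (suc y) λ′ * w)) eqW ⟩
    residue m * W λ′ * (j * R (suc y) λ′ * w) ≡⟨ rearrange₄ (residue m) (W λ′) j (R (suc y) λ′) w ⟩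
    residue m * w * W (suc y ∷ λ′) ∎
    where w = (node m - α (suc y)) * inv (node m - β (suc y))

-- Enumeration of strict partitions

∑-congᴬ : ∀ {A : Set} {xs : List A} {f h : A → ℚ} → All (λ x → f x ≡ h x) xs → ∑ xs f ≡ ∑ xs h
∑-congᴬ [] = refl
∑-congᴬ (p ∷ ps) = cong₂ _+_ p (∑-congᴬ ps)

ind : Bool → ℚ
ind true = 1ℚ
ind false = 0ℚ

ind-∧ : ∀ a b → ind (a ∧ b) ≡ ind a * ind b
ind-∧ true b = sym (*-identityˡ (ind b))
ind-∧ false b = sym (*-zeroˡ (ind b))

∑-ind-∧ : ∀ {A : Set} c (xs : List A) f → ∑ xs (λ x → ind (c ∧ f x)) ≡ ind c * ∑ xs (ind ∘ f)
∑-ind-∧ c xs f = trans (∑-cong xs (λ x → ind-∧ c (f x))) (∑-*ˡ xs (ind c) (ind ∘ f))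

T⇒true : ∀ {b} → T b → b ≡ true
T⇒true = Equivalence.to T-≡

true⇒T : ∀ {b} → b ≡ true → T b
true⇒T = Equivalence.from T-≡

≡ᵇ-true : ∀ n → (n ≡ᵇ n) ≡ true
≡ᵇ-true n = T⇒true (ℕ.≡⇒≡ᵇ n n refl)

≡ᵇ-false : ∀ {m n} → m ≢ n → (m ≡ᵇ n) ≡ false
≡ᵇ-false {m} {n} m≢n with m ≡ᵇ n in eq
... | true = contradiction (ℕ.≡ᵇ⇒≡ m n (true⇒T eq)) m≢n
... | false = refl

≤ᵇ-true : ∀ {m n} → m ≤ n → (m ≤ᵇ n) ≡ true
≤ᵇ-true m≤n = T⇒true (ℕ.≤⇒≤ᵇ m≤n)

≤ᵇ-false : ∀ {m n} → n < m → (m ≤ᵇ n) ≡ false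
≤ᵇ-false {m} {n} n<m with m ≤ᵇ n in eq
... | true = contradiction (ℕ.≤ᵇ⇒≤ m n (true⇒T eq)) (ℕ.<⇒≱ n<m)
... | false = refl

≡ᵇ-sym : ∀ m n → (m ≡ᵇ n) ≡ (n ≡ᵇ m)
≡ᵇ-sym zero zero = refl
≡ᵇ-sym zero (suc n) = refl
≡ᵇ-sym (suc m) zero = refl
≡ᵇ-sym (suc m) (suc n) = ≡ᵇ-sym m n

+-cancel-≡ᵇ : ∀ k m n → (k ℕ.+ m ≡ᵇ k ℕ.+ n) ≡ (m ≡ᵇ n)
+-cancel-≡ᵇ zero m n = refl
+-cancel-≡ᵇ (suc k) m n = +-cancel-≡ᵇ k m n

eqList-refl : ∀ κ → eqList κ κ ≡ true
eqList-refl [] = refl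
eqList-refl (y ∷ κ) = cong₂ _∧_ (≡ᵇ-true y) (eqList-refl κ)

eqList-sym : ∀ κ ν → eqList κ ν ≡ eqList ν κ
eqList-sym [] [] = refl
eqList-sym [] (_ ∷ _) = refl
eqList-sym (_ ∷ _) [] = refl
eqList-sym (y ∷ κ) (z ∷ ν) = cong₂ _∧_ (≡ᵇ-sym y z) (eqList-sym κ ν)

eqList⇒≡ : ∀ κ ν → eqList κ ν ≡ true → κ ≡ ν
eqList⇒≡ [] [] _ = refl
eqList⇒≡ (y ∷ κ) (z ∷ ν) eq with y ≡ᵇ z in eq′
... | true = cong₂ _∷_ (ℕ.≡ᵇ⇒≡ y z (true⇒T eq′)) (eqList⇒≡ κ ν eq)

ind-eqList-subst : ∀ κ ν (F : List ℕ → ℚ) → ind (eqList κ ν) * F ν ≡ ind (eqList κ ν) * F κ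
ind-eqList-subst κ ν F with eqList κ ν in eq
... | true = cong (λ z → 1ℚ * F z) (sym (eqList⇒≡ κ ν eq))
... | false = trans (*-zeroˡ (F ν)) (sym (*-zeroˡ (F κ)))

StrictBelow⇒positive : ∀ {b κ} → StrictBelow b κ → All (0 <_) κ
StrictBelow⇒positive [] = []
StrictBelow⇒positive (cons 0<y _ s) = 0<y ∷ StrictBelow⇒positive s

StrictBelow-size : ∀ {b κ} → StrictBelow b κ → StrictBelow (suc (size κ)) κ
StrictBelow-size [] = []
StrictBelow-size (cons 0<y y<b s) = cons 0<y (s≤s (ℕ.m≤m+n _ _)) s

sp-strict : ∀ n b → All (λ ν → StrictBelow (suc b) ν × size ν ≡ n) (sp n b)
sp-strict zero zero = ([] , refl) ∷ []
sp-strict (suc n) zero = []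
sp-strict n (suc b) = All.++⁺ (All.map (λ (s , eq) → weaken (ℕ.n≤1+n _) s , eq) (sp-strict n b)) second
  where
  second : All (λ ν → StrictBelow (suc (suc b)) ν × size ν ≡ n)
      (if suc b ≤ᵇ n then map (suc b ∷_) (sp (n ∸ suc b) b) else [])
  second with suc b ≤ᵇ n in eq
  ... | true = All.map⁺ (All.map (λ (s , eq′) → cons ℕ.z<s ℕ.≤-refl s ,
                 trans (cong (suc b ℕ.+_) eq′) (ℕ.m+[n∸m]≡n (ℕ.≤ᵇ⇒≤ (suc b) n (true⇒T eq))))
                     (sp-strict (n ∸ suc b) b))
  ... | false = []

SP-strict : ∀ N → All (λ ν → StrictBelow (suc N) ν × size ν ≡ N) (SP N)
SP-strict N = sp-strict N N

∑-zeroᴬ : ∀ {A : Set} {xs : List A} {f : A → ℚ} → All (λ x → f x ≡ 0ℚ) xs → ∑ xs f ≡ 0ℚ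
∑-zeroᴬ {xs = xs} ps = trans (∑-congᴬ ps) (∑-zero xs)

-- Each strict partition is enumerated exactly once: `sp` splits according to whether the largest
-- part is `suc b`, and only one of the two halves can contain `κ`.
∑-sp-eqList : ∀ {b κ} (F : List ℕ → ℚ) → StrictBelow (suc b) κ →
  ∑ (sp (size κ) b) (λ ν → ind (eqList κ ν) * F ν) ≡ F κ
∑-sp-eqList {zero} F [] = trans (+-identityʳ _) (*-identityˡ (F []))
∑-sp-eqList {zero} F (cons 0<y y<1 _) = contradiction y<1 (ℕ.≤⇒≯ 0<y)
∑-sp-eqList {suc b} F [] = trans (∑-++ (sp 0 b) [] _) (trans (+-identityʳ _) (∑-sp-eqList {b} F []))
∑-sp-eqList {suc b} {y ∷ κ} F (cons 0<y y<b s) with ℕ.m≤n⇒m<n∨m≡n (ℕ.≤-pred y<b)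
... | inj₁ y<b′ = begin
  ∑ (sp n b ++ second) G  ≡⟨ ∑-++ (sp n b) second G ⟩
  ∑ (sp n b) G + ∑ second G  ≡⟨ cong₂ _+_ (∑-sp-eqList F (cons 0<y y<b′ s)) second≡0 ⟩
  F (y ∷ κ) + 0ℚ  ≡⟨ +-identityʳ _ ⟩
  F (y ∷ κ) ∎
  where
  n = y ℕ.+ size κ
  G : List ℕ → ℚ
  G = λ ν → ind (eqList (y ∷ κ) ν) * F ν
  second = if suc b ≤ᵇ n then map (suc b ∷_) (sp (n ∸ suc b) b) else []
  second≡0 : ∑ second G ≡ 0ℚ
  second≡0 with suc b ≤ᵇ n
  ... | false = refl
  ... | true = trans (∑-map (suc b ∷_) (sp (n ∸ suc b) b) G) (trans (∑-cong (sp (n ∸ suc b) b) λ ν →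
          trans (cong (λ c → ind (c ∧ eqList κ ν) * F (suc b ∷ ν)) (≡ᵇ-false (ℕ.<⇒≢ y<b′)))
              (*-zeroˡ (F (suc b ∷ ν)))) (∑-zero (sp (n ∸ suc b) b)))
... | inj₂ refl = begin
  ∑ (sp n b ++ second) G  ≡⟨ ∑-++ (sp n b) second G ⟩
  ∑ (sp n b) G + ∑ second G  ≡⟨ cong₂ _+_ (∑-zeroᴬ (All.map first≡0 (sp-strict n b))) second≡ ⟩
  0ℚ + F (suc b ∷ κ)  ≡⟨ +-identityˡ _ ⟩
  F (suc b ∷ κ) ∎
  where
  n = suc b ℕ.+ size κ
  G : List ℕ → ℚ
  G = λ ν → ind (eqList (suc b ∷ κ) ν) * F ν
  second = if suc b ≤ᵇ n then map (suc b ∷_) (sp (n ∸ suc b) b) else []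
  first≡0 : ∀ {ν} → StrictBelow (suc b) ν × size ν ≡ n → G ν ≡ 0ℚ
  first≡0 ([] , _) = *-zeroˡ (F [])
  first≡0 {z ∷ ν} (cons _ z<b _ , _) = trans (cong (λ c → ind (c ∧ eqList κ ν) * F (z ∷ ν))
      (≡ᵇ-false (≢-sym (ℕ.<⇒≢ z<b)))) (*-zeroˡ (F (z ∷ ν)))
  second≡ : ∑ second G ≡ F (suc b ∷ κ)
  second≡ = begin
    ∑ second G ≡⟨ cong (λ c → ∑ (if c then map (suc b ∷_) (sp (n ∸ suc b) b) else []) G)
        (≤ᵇ-true (ℕ.m≤m+n (suc b) (size κ))) ⟩
    ∑ (map (suc b ∷_) (sp (n ∸ suc b) b)) G ≡⟨ ∑-map (suc b ∷_) (sp (n ∸ suc b) b) G ⟩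
    ∑ (sp (n ∸ suc b) b) (λ ν → ind ((b ≡ᵇ b) ∧ eqList κ ν) * F (suc b ∷ ν))
      ≡⟨ cong₂ (λ k c → ∑ (sp k b) (λ ν → ind (c ∧ eqList κ ν) * F (suc b ∷ ν))) (ℕ.m+n∸m≡n b (size κ)) (≡ᵇ-true b) ⟩
    ∑ (sp (size κ) b) (λ ν → ind (eqList κ ν) * F (suc b ∷ ν)) ≡⟨ ∑-sp-eqList (F ∘ (suc b ∷_)) s ⟩
    F (suc b ∷ κ) ∎

-- The second alternative admits targets of moves that are not strict and hence missing from `SP N`.
∑-SP-eqList : ∀ {b κ N} (F : List ℕ → ℚ) → size κ ≡ N → StrictBelow b κ ⊎ F κ ≡ 0ℚ →
  ∑ (SP N) (λ ν → ind (eqList κ ν) * F ν) ≡ F κ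
∑-SP-eqList F refl (inj₁ s) = ∑-sp-eqList F (StrictBelow-size s)
∑-SP-eqList {κ = κ} {N} F _ (inj₂ F≡0) = trans (∑-cong (SP N) (λ ν → trans (ind-eqList-subst κ ν F)
  (trans (cong (ind (eqList κ ν) *_) F≡0) (*-zeroʳ (ind (eqList κ ν)))))) (trans (∑-zero (SP N)) (sym F≡0))

shiftedSub⇒size≤ : ∀ λ′ ν → shiftedSub λ′ ν ≡ true → size λ′ ≤ size ν
shiftedSub⇒size≤ [] ν _ = z≤n
shiftedSub⇒size≤ (y ∷ λ′) (z ∷ ν) eq with y ≤ᵇ z in eq′
... | true = ℕ.+-mono-≤ (ℕ.≤ᵇ⇒≤ y z (true⇒T eq′)) (shiftedSub⇒size≤ λ′ ν eq)

∧-false : ∀ {a b} → (a ≡ true → b ≡ false) → a ∧ b ≡ false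
∧-false {true} h = h refl
∧-false {false} h = refl

sub∧size : ∀ λ′ ν → All (0 <_) ν → shiftedSub λ′ ν ∧ (size ν ≡ᵇ size λ′) ≡ eqList λ′ ν
sub∧size [] [] _ = refl
sub∧size [] (suc z ∷ ν) _ = refl
sub∧size [] (zero ∷ ν) (() ∷ _)
sub∧size (y ∷ λ′) [] _ = refl
sub∧size (y ∷ λ′) (z ∷ ν) (_ ∷ ps) with ℕ.<-cmp y z
... | tri< y<z y≢z _ = trans (cong₂ (λ c d → (c ∧ shiftedSub λ′ ν) ∧ d) (≤ᵇ-true (ℕ.<⇒≤ y<z)) refl)
    (trans (∧-false (λ sub → ≡ᵇ-false (≢-sym (ℕ.<⇒≢ (ℕ.+-mono-<-≤ y<z (shiftedSub⇒size≤ λ′ ν sub))))))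
    (cong (_∧ eqList λ′ ν) (sym (≡ᵇ-false y≢z))))
... | tri≈ _ refl _ = trans (cong₂ (λ c d → (c ∧ shiftedSub λ′ ν) ∧ d) (≤ᵇ-true {y} ℕ.≤-refl)
    (+-cancel-≡ᵇ y (size ν) (size λ′)))
    (trans (sub∧size λ′ ν ps) (cong (_∧ eqList λ′ ν) (sym (≡ᵇ-true y))))
... | tri> _ y≢z z<y = trans (cong (λ c → (c ∧ shiftedSub λ′ ν) ∧ (z ℕ.+ size ν ≡ᵇ y ℕ.+ size λ′)) (≤ᵇ-false z<y))
    (cong (_∧ eqList λ′ ν) (sym (≡ᵇ-false y≢z)))

-- Compare the first rows. If they agree, the box lies further down; if they differ by one, the
-- remainders have equal size and containment forces equality; a larger gap already adds too many
-- boxes.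
count-up : ∀ λ′ ν → All (0 <_) ν → ind (addsOneBox λ′ ν) ≡ ∑ (up λ′) (λ m → ind (eqList (target m) ν))
count-up [] [] _ = refl
count-up [] (suc zero ∷ []) _ = refl
count-up [] (suc zero ∷ suc _ ∷ _) _ = refl
count-up [] (suc (suc z) ∷ ν) _ = refl
count-up [] (suc zero ∷ zero ∷ _) (_ ∷ () ∷ _)
count-up [] (zero ∷ _) (() ∷ _)
count-up (y ∷ λ′) [] _ = sym (trans (+-identityˡ _) (trans (∑-map _ (up λ′) _) (∑-zero (up λ′))))
count-up (y ∷ λ′) (z ∷ ν) (_ ∷ ps) = begin
  ind (((y ≤ᵇ z) ∧ shiftedSub λ′ ν) ∧ (z ℕ.+ size ν ≡ᵇ suc (y ℕ.+ size λ′))) ≡⟨ cases (ℕ.<-cmp y z) ⟩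
  ind ((suc y ≡ᵇ z) ∧ eqList λ′ ν) + ind (y ≡ᵇ z) * Σ′ ≡⟨ cong (ind ((suc y ≡ᵇ z) ∧ eqList λ′ ν) +_)
      (sym (∑-ind-∧ (y ≡ᵇ z) (up λ′) _)) ⟩
  ind ((suc y ≡ᵇ z) ∧ eqList λ′ ν) + ∑ (up λ′) (λ m → ind ((y ≡ᵇ z) ∧ eqList (target m) ν))
    ≡⟨ cong (ind ((suc y ≡ᵇ z) ∧ eqList λ′ ν) +_) (sym (∑-map _ (up λ′) _)) ⟩
  _ ∎
  where
  Σ′ = ∑ (up λ′) (λ m → ind (eqList (target m) ν))
  lhs rhs : Bool → Bool → ℚ
  lhs c d = ind ((c ∧ shiftedSub λ′ ν) ∧ d)
  rhs c d = ind (c ∧ eqList λ′ ν) + ind d * Σ′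
  vanish : 0ℚ + 0ℚ * Σ′ ≡ 0ℚ
  vanish = trans (+-identityˡ _) (*-zeroˡ Σ′)
  cases : _ → ind (((y ≤ᵇ z) ∧ shiftedSub λ′ ν) ∧ (z ℕ.+ size ν ≡ᵇ suc (y ℕ.+ size λ′)))
    ≡ ind ((suc y ≡ᵇ z) ∧ eqList λ′ ν) + ind (y ≡ᵇ z) * Σ′
  cases (tri> _ y≢z z<y) = trans (cong (λ c → lhs c (z ℕ.+ size ν ≡ᵇ suc (y ℕ.+ size λ′))) (≤ᵇ-false z<y))
    (sym (trans (cong₂ rhs (≡ᵇ-false (≢-sym (ℕ.<⇒≢ (ℕ.m<n⇒m<1+n z<y)))) (≡ᵇ-false y≢z)) vanish))
  cases (tri≈ _ refl _) = begin
    ind (((y ≤ᵇ y) ∧ shiftedSub λ′ ν) ∧ (y ℕ.+ size ν ≡ᵇ suc (y ℕ.+ size λ′)))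
      ≡⟨ cong₂ lhs (≤ᵇ-true {y} ℕ.≤-refl) (trans (cong (y ℕ.+ size ν ≡ᵇ_) (sym (ℕ.+-suc y (size λ′))))
          (+-cancel-≡ᵇ y _ _)) ⟩
    ind (addsOneBox λ′ ν) ≡⟨ count-up λ′ ν ps ⟩
    Σ′ ≡⟨ sym (trans (+-identityˡ _) (*-identityˡ Σ′)) ⟩
    0ℚ + 1ℚ * Σ′ ≡⟨ sym (cong₂ rhs (≡ᵇ-false (ℕ.1+n≢n {y})) (≡ᵇ-true y)) ⟩
    _ ∎
  cases (tri< y<z y≢z _) with ℕ.m≤n⇒m<n∨m≡n y<z
  ... | inj₂ refl = begin
    ind (((y ≤ᵇ suc y) ∧ shiftedSub λ′ ν) ∧ (y ℕ.+ size ν ≡ᵇ y ℕ.+ size λ′))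
      ≡⟨ cong₂ lhs (≤ᵇ-true (ℕ.n≤1+n y)) (+-cancel-≡ᵇ y _ _) ⟩
    ind (shiftedSub λ′ ν ∧ (size ν ≡ᵇ size λ′)) ≡⟨ cong ind (sub∧size λ′ ν ps) ⟩
    ind (eqList λ′ ν) ≡⟨ sym (trans (cong (ind (eqList λ′ ν) +_) (*-zeroˡ Σ′)) (+-identityʳ _)) ⟩
    ind (eqList λ′ ν) + 0ℚ * Σ′ ≡⟨ sym (cong₂ rhs (≡ᵇ-true y) (≡ᵇ-false y≢z)) ⟩
    _ ∎
  ... | inj₁ y<<z = trans (cong ind (trans (cong (λ c → (c ∧ shiftedSub λ′ ν) ∧
      (z ℕ.+ size ν ≡ᵇ suc (y ℕ.+ size λ′))) (≤ᵇ-true (ℕ.<⇒≤ y<z)))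
       (∧-false (λ sub → ≡ᵇ-false (≢-sym (ℕ.<⇒≢ (ℕ.+-mono-<-≤ y<<z (shiftedSub⇒size≤ λ′ ν sub))))))))
    (sym (trans (cong₂ rhs (≡ᵇ-false (ℕ.<⇒≢ y<<z)) (≡ᵇ-false y≢z)) vanish))

up-nonempty : ∀ ν → ∑ (up ν) (λ m → ind (eqList (target m) [])) ≡ 0ℚ
up-nonempty [] = refl
up-nonempty (z ∷ ν) = trans (+-identityˡ _) (trans (∑-map _ (up ν) _) (∑-zero (up ν)))

-- Both move lists are built row by row and match term by term; opening a row of length 1 in `up` is
-- answered by `lower` deleting such a row in `down`. Thus sums over predecessors become sums over
-- `down`.
up-down-dual : ∀ {b λ′} ν → All (0 <_) ν → StrictBelow b λ′ →
  ∑ (up ν) (λ m → ind (eqList (target m) λ′)) ≡ ∑ (down λ′) (λ m → ind (eqList (target m) ν))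
up-down-dual ν _ [] = up-nonempty ν
up-down-dual [] _ (cons {y = suc y} {λ′} _ _ s) = cong₂ _+_ (cong ind (head y s))
    (sym (trans (∑-map _ (down λ′) _) (∑-zero (down λ′))))
  where
  head : ∀ y {λ′} → StrictBelow (suc y) λ′ → (0 ≡ᵇ y) ∧ eqList [] λ′ ≡ eqList (lower (suc y) λ′) []
  head zero [] = refl
  head zero (cons {y = suc _} _ (s≤s ()) _)
  head (suc y) _ = refl
up-down-dual (z ∷ ν) (0<z ∷ ps) (cons {y = suc y} {λ′} _ _ s) = cong₂ _+_ (cong ind (head y s))
  (trans (∑-map _ (up ν) _) (trans (trans (∑-ind-∧ (z ≡ᵇ suc y) (up ν) _)
    (trans (cong₂ (λ c q → ind c * q) (≡ᵇ-sym z (suc y)) (up-down-dual ν ps s))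
        (sym (∑-ind-∧ (suc y ≡ᵇ z) (down λ′) _))))
    (sym (∑-map _ (down λ′) _))))
  where
  head : ∀ y {λ′} → StrictBelow (suc y) λ′ → (z ≡ᵇ y) ∧ eqList ν λ′ ≡ eqList (lower (suc y) λ′) (z ∷ ν)
  head zero [] = cong (_∧ eqList ν []) (≡ᵇ-false (≢-sym (ℕ.<⇒≢ 0<z)))
  head zero (cons {y = suc _} _ (s≤s ()) _)
  head (suc y) {λ′} _ = cong₂ _∧_ (≡ᵇ-sym z (suc y)) (eqList-sym ν λ′)

-- The shifted hook formula and the growth process

private
  -- A single move can break strictness only by making two neighbouring rows equal, and then the
  -- factor `q - q` of `R` vanishes.
  strict-or-zero : ∀ {y κ} → StrictBelow (suc y) κ → StrictBelow y κ ⊎ R y κ ≡ 0ℚ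
  strict-or-zero [] = inj₁ []
  strict-or-zero {y} (cons {y = z} {κ} 0<z z<y s) with ℕ.m≤n⇒m<n∨m≡n (ℕ.≤-pred z<y)
  ... | inj₁ z<y′ = inj₁ (cons 0<z z<y′ s)
  ... | inj₂ refl = inj₂ (vanish (ℕtoℚ z) (inv (ℕtoℚ z + ℕtoℚ z)) (R z κ))
    where
    vanish : ∀ q i r → (q - q) * i * r ≡ 0ℚ
    vanish = solve-∀ ℚ-ring

  W-zero : ∀ y κ → W κ ≡ 0ℚ → W (y ∷ κ) ≡ 0ℚ
  W-zero y κ eq = trans (cong (λ w → w * inv (ℕtoℚ (y !)) * R y κ) eq) (vanish (inv (ℕtoℚ (y !))) (R y κ))
    where
    vanish : ∀ i r → 0ℚ * i * r ≡ 0ℚ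
    vanish = solve-∀ ℚ-ring

  R-zero⇒W-zero : ∀ y κ → R y κ ≡ 0ℚ → W (y ∷ κ) ≡ 0ℚ
  R-zero⇒W-zero y κ eq = trans (cong (W κ * inv (ℕtoℚ (y !)) *_) eq) (*-zeroʳ (W κ * inv (ℕtoℚ (y !))))

up-target : ∀ {b λ′} → 0 < b → StrictBelow b λ′ →
  All (λ m → StrictBelow (suc b) (target m) ⊎ W (target m) ≡ 0ℚ) (up λ′)
up-target 0<b [] = inj₁ (cons ℕ.z<s (s≤s 0<b) []) ∷ []
up-target {b} 0<b (cons {y = y} {λ′} 0<y y<b s) =
  inj₁ (cons ℕ.z<s (s≤s y<b) (weaken (ℕ.n≤1+n y) s)) ∷ All.map⁺ (All.map (λ {m} → tail m) (up-target 0<y s))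
  where
  tail : ∀ m → StrictBelow (suc y) (target m) ⊎ W (target m) ≡ 0ℚ → StrictBelow (suc b) (y ∷ target m)
    ⊎ W (y ∷ target m) ≡ 0ℚ
  tail m (inj₂ W≡0) = inj₂ (W-zero y (target m) W≡0)
  tail m (inj₁ s′) with strict-or-zero s′
  ... | inj₁ s″ = inj₁ (cons 0<y (ℕ.m<n⇒m<1+n y<b) s″)
  ... | inj₂ R≡0 = inj₂ (R-zero⇒W-zero y (target m) R≡0)

down-target : ∀ {b λ′} → StrictBelow b λ′ → All (λ m → StrictBelow b (target m) ⊎ W (target m) ≡ 0ℚ) (down λ′)
down-target [] = []
down-target {b} (cons {y = suc y} {λ′} 0<y y<b s) = head y y<b s ∷ All.map⁺ (All.map (λ {m} → tail m) (down-target s))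
  where
  head : ∀ y → suc y < b → StrictBelow (suc y) λ′ → StrictBelow b (lower (suc y) λ′) ⊎ W (lower (suc y) λ′) ≡ 0ℚ
  head zero 1<b s = inj₁ (weaken (ℕ.<⇒≤ 1<b) s)
  head (suc y) y<b s with strict-or-zero s
  ... | inj₁ s′ = inj₁ (cons ℕ.z<s (ℕ.<-trans ℕ.≤-refl y<b) s′)
  ... | inj₂ R≡0 = inj₂ (R-zero⇒W-zero (suc y) λ′ R≡0)
  tail : ∀ m → StrictBelow (suc y) (target m) ⊎ W (target m) ≡ 0ℚ → StrictBelow b (suc y ∷ target m)
    ⊎ W (suc y ∷ target m) ≡ 0ℚ
  tail m (inj₁ s′) = inj₁ (cons 0<y y<b s′)
  tail m (inj₂ W≡0) = inj₂ (W-zero (suc y) (target m) W≡0)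

up-size : ∀ λ′ → All (λ m → size (target m) ≡ suc (size λ′)) (up λ′)
up-size [] = refl ∷ []
up-size (y ∷ λ′) = refl ∷ All.map⁺ (All.map (λ eq → trans (cong (y ℕ.+_) eq) (ℕ.+-suc y (size λ′))) (up-size λ′))

down-size : ∀ {b λ′} → StrictBelow b λ′ → All (λ m → suc (size (target m)) ≡ size λ′) (down λ′)
down-size [] = []
down-size (cons {y = suc y} {λ′} _ _ s) = head y ∷ All.map⁺
    (All.map (λ eq → trans (sym (cong suc (ℕ.+-suc y _))) (cong (suc y ℕ.+_) eq)) (down-size s))
  where
  head : ∀ y → suc (size (lower (suc y) λ′)) ≡ suc y ℕ.+ size λ′
  head zero = refl
  head (suc y) = refl

-- The condition on `F` disposes of the moves with a non-strict target, which have no counterpart in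
-- `SP`.
∑-SP-up : ∀ {b λ′} (F : List ℕ → ℚ) → StrictBelow b λ′ → (∀ κ → W κ ≡ 0ℚ → F κ ≡ 0ℚ) →
  ∑ (SP (suc (size λ′))) (λ ν → ind (addsOneBox λ′ ν) * F ν) ≡ ∑ (up λ′) (F ∘ target)
∑-SP-up {b} {λ′} F s vanish = begin
  ∑ SP′ (λ ν → ind (addsOneBox λ′ ν) * F ν)
    ≡⟨ ∑-congᴬ (All.map (λ {ν} (s , _) → trans (cong (_* F ν) (count-up λ′ ν (StrictBelow⇒positive s)))
        (sym (∑-*ʳ (up λ′) (F ν) _))) (SP-strict (suc (size λ′)))) ⟩
  ∑ SP′ (λ ν → ∑ (up λ′) (λ m → ind (eqList (target m) ν) * F ν)) ≡⟨ ∑-swap SP′ (up λ′) _ ⟩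
  ∑ (up λ′) (λ m → ∑ SP′ (λ ν → ind (eqList (target m) ν) * F ν))
    ≡⟨ ∑-congᴬ (All.zipWith (λ { {m} (inj₁ s , eq) → ∑-SP-eqList F eq (inj₁ s)
                               ; {m} (inj₂ W≡0 , eq) → ∑-SP-eqList {0} F eq (inj₂ (vanish _ W≡0)) })
                (up-target ℕ.z<s (StrictBelow-size s) , up-size λ′)) ⟩
  ∑ (up λ′) (F ∘ target) ∎
  where SP′ = SP (suc (size λ′))

∑-SP-down : ∀ {b λ′ j} (F : List ℕ → ℚ) → StrictBelow b λ′ → size λ′ ≡ suc j → (∀ κ → W κ ≡ 0ℚ → F κ ≡ 0ℚ) →
  ∑ (SP j) (λ ν → ind (addsOneBox ν λ′) * F ν) ≡ ∑ (down λ′) (F ∘ target)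
∑-SP-down {b} {λ′} {j} F s eqj vanish = begin
  ∑ (SP j) (λ ν → ind (addsOneBox ν λ′) * F ν)
    ≡⟨ ∑-congᴬ (All.map (λ {ν} (s′ , _) → trans (cong (_* F ν) (trans (count-up ν λ′ (StrictBelow⇒positive s))
         (up-down-dual ν (StrictBelow⇒positive s′) s))) (sym (∑-*ʳ (down λ′) (F ν) _))) (SP-strict j)) ⟩
  ∑ (SP j) (λ ν → ∑ (down λ′) (λ m → ind (eqList (target m) ν) * F ν)) ≡⟨ ∑-swap (SP j) (down λ′) _ ⟩
  ∑ (down λ′) (λ m → ∑ (SP j) (λ ν → ind (eqList (target m) ν) * F ν))
    ≡⟨ ∑-congᴬ (All.zipWith (λ { {m} (inj₁ s , eq) → ∑-SP-eqList F (ℕ.suc-injective (trans eq eqj)) (inj₁ s)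
                               ; {m} (inj₂ W≡0 , eq) → ∑-SP-eqList {0} F (ℕ.suc-injective (trans eq eqj))
                                   (inj₂ (vanish _ W≡0)) })
                (down-target s , down-size s)) ⟩
  ∑ (down λ′) (F ∘ target) ∎

-- The residues add up to the coefficient of `u⁻¹` at infinity, to which a row of length `y`
-- contributes `β y - α y = - 2 y`.
down-total : ∀ {b λ′} → StrictBelow b λ′ → moment (down λ′) 0 ≡ - (2ℚ * ℕtoℚ (size λ′))
down-total [] = refl
down-total (cons {y = y} {λ′} 0<y y<b s) = begin
  moment (down (y ∷ λ′)) 0 ≡⟨ moment-extend-zero 1ℚ (α y) (β y) (lower y λ′) (y ∷_) (down λ′)
      (down-nodes≢ ℕ.≤-refl s) ⟩
  moment (down λ′) 0 + 1ℚ * (β y - α y) ≡⟨ cong (_+ 1ℚ * (β y - α y)) (down-total s) ⟩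
  - (2ℚ * ℕtoℚ (size λ′)) + 1ℚ * (β y - α y) ≡⟨ ring (ℕtoℚ y) (ℕtoℚ (size λ′)) ⟩
  - (2ℚ * (ℕtoℚ y + ℕtoℚ (size λ′))) ≡⟨ cong (λ q → - (2ℚ * q)) (sym (ℕtoℚ-+ y (size λ′))) ⟩
  - (2ℚ * ℕtoℚ (y ℕ.+ size λ′)) ∎
  where
  ring : ∀ q s → - ((1ℚ + 1ℚ) * s) + 1ℚ * (q * (q - 1ℚ) - q * (1ℚ + q)) ≡ - ((1ℚ + 1ℚ) * (q + s))
  ring = solve-∀ ℚ-ring

-- Add up `W-down` over all removable boxes and insert the total residue. This is the branching rule
-- `g λ = Σ g λ⁻` divided by `j !`, in terms of `W`.
W-harmonic : ∀ {b λ′ j} → StrictBelow b λ′ → size λ′ ≡ suc j →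
  ∑ (SP j) (λ ν → ind (addsOneBox ν λ′) * W ν) ≡ ℕtoℚ (suc j) * W λ′
W-harmonic {λ′ = λ′} {j} s eq = *-cancelˡ { - 2ℚ} (λ ()) (begin
  - 2ℚ * ∑ (SP j) (λ ν → ind (addsOneBox ν λ′) * W ν) ≡⟨ cong (- 2ℚ *_) (∑-SP-down W s eq (λ _ W≡0 → W≡0)) ⟩
  - 2ℚ * ∑ (down λ′) (W ∘ target) ≡⟨ sym (∑-*ˡ (down λ′) (- 2ℚ) _) ⟩
  ∑ (down λ′) (λ m → - 2ℚ * W (target m)) ≡⟨ ∑-congᴬ
      (All.map (λ {m} eq′ → trans (sym (neg-distribˡ-* 2ℚ (W (target m))))
     (trans eq′ (cong (_* W λ′) (sym (*-identityʳ (residue m)))))) (W-down s)) ⟩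
  ∑ (down λ′) (λ m → residue m * 1ℚ * W λ′) ≡⟨ ∑-*ʳ (down λ′) (W λ′) _ ⟩
  moment (down λ′) 0 * W λ′ ≡⟨ cong (_* W λ′) (trans (down-total s) (cong (λ n → - (2ℚ * ℕtoℚ n)) eq)) ⟩
  - (2ℚ * ℕtoℚ (suc j)) * W λ′ ≡⟨ cong (_* W λ′) (neg-distribˡ-* 2ℚ (ℕtoℚ (suc j))) ⟩
  - 2ℚ * ℕtoℚ (suc j) * W λ′ ≡⟨ *-assoc (- 2ℚ) (ℕtoℚ (suc j)) (W λ′) ⟩
  - 2ℚ * (ℕtoℚ (suc j) * W λ′) ∎)

ℕtoℚ-if : ∀ c n → ℕtoℚ (if c then n else 0) ≡ ind c * ℕtoℚ n
ℕtoℚ-if true n = sym (*-identityˡ (ℕtoℚ n))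
ℕtoℚ-if false n = sym (*-zeroˡ (ℕtoℚ n))

ℕtoℚ-sum : ∀ {A : Set} (f : A → ℕ) xs → ℕtoℚ (sum (map f xs)) ≡ ∑ xs (ℕtoℚ ∘ f)
ℕtoℚ-sum f [] = refl
ℕtoℚ-sum f (x ∷ xs) = trans (ℕtoℚ-+ (f x) _) (cong (ℕtoℚ (f x) +_) (ℕtoℚ-sum f xs))

chainsℚ : ℕ → List ℕ → List ℕ → ℚ
chainsℚ n μ λ′ = ℕtoℚ (chains n μ λ′)

chains-zero : ∀ μ λ′ → chainsℚ 0 μ λ′ ≡ ind (eqList μ λ′)
chains-zero μ λ′ = trans (ℕtoℚ-if (eqList μ λ′) 1) (*-identityʳ _)

chains-suc : ∀ k μ λ′ → chainsℚ (suc k) μ λ′ ≡ ∑ (SP (suc (size μ))) (λ ν → ind (addsOneBox μ ν) * chainsℚ k ν λ′)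
chains-suc k μ λ′ = trans (ℕtoℚ-sum _ (SP (suc (size μ))))
    (∑-cong (SP (suc (size μ))) (λ ν → ℕtoℚ-if (addsOneBox μ ν) (chains k ν λ′)))

-- `chains` peels off the first box while `W-harmonic` concerns the last one. Starting chains at
-- level `j` with weight `W` lets harmonicity raise `j` as `chains` loses a step; `j = 0` is the
-- hook formula.
W-chains : ∀ {b λ′} j k → StrictBelow b λ′ → size λ′ ≡ j ℕ.+ k →
  ℕtoℚ (j !) * ∑ (SP j) (λ ν → W ν * chainsℚ k ν λ′) ≡ ℕtoℚ ((j ℕ.+ k) !) * W λ′
W-chains {λ′ = λ′} j zero s eq = cong₂ _*_ (cong (λ n → ℕtoℚ (n !)) (sym (ℕ.+-identityʳ j))) (begin
  ∑ (SP j) (λ ν → W ν * chainsℚ 0 ν λ′)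
    ≡⟨ ∑-cong (SP j) (λ ν → trans (cong (W ν *_) (trans (chains-zero ν λ′) (cong ind (eqList-sym ν λ′))))
        (*-comm (W ν) _)) ⟩
  ∑ (SP j) (λ ν → ind (eqList λ′ ν) * W ν) ≡⟨ ∑-SP-eqList W (trans eq (ℕ.+-identityʳ j)) (inj₁ s) ⟩
  W λ′ ∎)
W-chains {λ′ = λ′} j (suc k) s eq = begin
  ℕtoℚ (j !) * ∑ (SP j) (λ ν → W ν * chainsℚ (suc k) ν λ′)
    ≡⟨ cong (ℕtoℚ (j !) *_) (∑-congᴬ (All.map (λ {ν} (_ , eq) → trans (cong (W ν *_) (trans (chains-suc k ν λ′)
         (cong (λ n → ∑ (SP (suc n)) (λ ν′ → ind (addsOneBox ν ν′) * chainsℚ k ν′ λ′)) eq)))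
             (sym (∑-*ˡ (SP (suc j)) (W ν) _))) (SP-strict j))) ⟩
  ℕtoℚ (j !) * ∑ (SP j) (λ ν → ∑ (SP (suc j)) (λ ν′ → W ν * (ind (addsOneBox ν ν′) * chainsℚ k ν′ λ′)))
    ≡⟨ cong (ℕtoℚ (j !) *_) (∑-swap (SP j) (SP (suc j)) _) ⟩
  ℕtoℚ (j !) * ∑ (SP (suc j)) (λ ν′ → ∑ (SP j) (λ ν → W ν * (ind (addsOneBox ν ν′) * chainsℚ k ν′ λ′)))
    ≡⟨ cong (ℕtoℚ (j !) *_) (∑-congᴬ (All.map (λ {ν′} → step ν′) (SP-strict (suc j)))) ⟩
  ℕtoℚ (j !) * ∑ (SP (suc j)) (λ ν′ → ℕtoℚ (suc j) * (W ν′ * chainsℚ k ν′ λ′))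
    ≡⟨ cong (ℕtoℚ (j !) *_) (∑-*ˡ (SP (suc j)) (ℕtoℚ (suc j)) _) ⟩
  ℕtoℚ (j !) * (ℕtoℚ (suc j) * Σ′) ≡⟨ rearrange₂ (ℕtoℚ (j !)) (ℕtoℚ (suc j)) Σ′ ⟩
  ℕtoℚ (suc j) * ℕtoℚ (j !) * Σ′ ≡⟨ cong (_* Σ′) (sym (ℕtoℚ-* (suc j) (j !))) ⟩
  ℕtoℚ (suc j !) * Σ′ ≡⟨ W-chains (suc j) k s (trans eq (ℕ.+-suc j k)) ⟩
  ℕtoℚ ((suc j ℕ.+ k) !) * W λ′ ≡⟨ cong (λ n → ℕtoℚ (n !) * W λ′) (sym (ℕ.+-suc j k)) ⟩
  ℕtoℚ ((j ℕ.+ suc k) !) * W λ′ ∎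
  where
  Σ′ = ∑ (SP (suc j)) (λ ν′ → W ν′ * chainsℚ k ν′ λ′)
  rearrange₁ : ∀ w i c → w * (i * c) ≡ i * w * c
  rearrange₁ = solve-∀ ℚ-ring
  rearrange₂ : ∀ x y z → x * (y * z) ≡ y * x * z
  rearrange₂ = solve-∀ ℚ-ring
  step : ∀ ν′ → StrictBelow (suc (suc j)) ν′ × size ν′ ≡ suc j →
    ∑ (SP j) (λ ν → W ν * (ind (addsOneBox ν ν′) * chainsℚ k ν′ λ′)) ≡ ℕtoℚ (suc j) * (W ν′ * chainsℚ k ν′ λ′)
  step ν′ (s , eq) = begin
    ∑ (SP j) (λ ν → W ν * (ind (addsOneBox ν ν′) * chainsℚ k ν′ λ′)) ≡⟨ ∑-cong (SP j)
        (λ ν → rearrange₁ (W ν) (ind (addsOneBox ν ν′)) (chainsℚ k ν′ λ′)) ⟩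
    ∑ (SP j) (λ ν → ind (addsOneBox ν ν′) * W ν * chainsℚ k ν′ λ′) ≡⟨ ∑-*ʳ (SP j) (chainsℚ k ν′ λ′) _ ⟩
    ∑ (SP j) (λ ν → ind (addsOneBox ν ν′) * W ν) * chainsℚ k ν′ λ′ ≡⟨ cong (_* chainsℚ k ν′ λ′) (W-harmonic s eq) ⟩
    ℕtoℚ (suc j) * W ν′ * chainsℚ k ν′ λ′ ≡⟨ *-assoc (ℕtoℚ (suc j)) (W ν′) (chainsℚ k ν′ λ′) ⟩
    ℕtoℚ (suc j) * (W ν′ * chainsℚ k ν′ λ′) ∎

shifted-hook : ∀ {b λ′} → StrictBelow b λ′ → ℕtoℚ (g λ′) ≡ ℕtoℚ (size λ′ !) * W λ′
shifted-hook {λ′ = λ′} s = trans (unit (ℕtoℚ (g λ′))) (W-chains 0 (size λ′) s refl)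
  where
  unit : ∀ q → q ≡ 1ℚ * (1ℚ * q + 0ℚ)
  unit = solve-∀ ℚ-ring

-- Up to a factor independent of n, 2ⁿ S (n + |μ|) n μ f is 𝔼_{μ,n}[f].
S : ℕ → ℕ → List ℕ → (List ℕ → ℚ) → ℚ
S N n μ f = ∑ (SP N) (λ λ′ → V λ′ * (chainsℚ n μ λ′ * f λ′))

step-mean : (List ℕ → ℚ) → List ℕ → ℚ
step-mean f λ′ = ∑ (up λ′) (λ m → residue m * f (target m))

S-zero : ∀ {b μ N} f → StrictBelow b μ → size μ ≡ N → S N 0 μ f ≡ V μ * f μ
S-zero {μ = μ} {N} f s eq = trans (∑-cong (SP N) (λ λ′ → trans (cong (λ c → V λ′ * (c * f λ′)) (chains-zero μ λ′))
    (rearrange (V λ′) (ind (eqList μ λ′)) (f λ′)))) (∑-SP-eqList (λ λ′ → V λ′ * f λ′) eq (inj₁ s))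
  where
  rearrange : ∀ v i f → v * (i * f) ≡ i * (v * f)
  rearrange = solve-∀ ℚ-ring

S-suc : ∀ N n μ f → S N (suc n) μ f ≡ ∑ (SP (suc (size μ))) (λ ν → ind (addsOneBox μ ν) * S N n ν f)
S-suc N n μ f = begin
  S N (suc n) μ f ≡⟨ ∑-cong (SP N) (λ λ′ → trans (cong (λ c → V λ′ * (c * f λ′)) (chains-suc n μ λ′))
      (trans (rearrange₁ (V λ′) (∑ (SP (suc (size μ))) (λ ν → ind (addsOneBox μ ν) * chainsℚ n ν λ′)) (f λ′))
          (sym (∑-*ʳ (SP (suc (size μ))) (V λ′ * f λ′) _)))) ⟩
  ∑ (SP N) (λ λ′ → ∑ (SP (suc (size μ))) (λ ν → ind (addsOneBox μ ν) * chainsℚ n ν λ′ * (V λ′ * f λ′))) ≡⟨ ∑-swap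
      (SP N) (SP (suc (size μ))) _ ⟩
  ∑ (SP (suc (size μ))) (λ ν → ∑ (SP N) (λ λ′ → ind (addsOneBox μ ν) * chainsℚ n ν λ′ * (V λ′ * f λ′)))
    ≡⟨ ∑-cong (SP (suc (size μ))) (λ ν → trans (∑-cong (SP N)
        (λ λ′ → rearrange₂ (ind (addsOneBox μ ν)) (chainsℚ n ν λ′) (V λ′) (f λ′)))
         (∑-*ˡ (SP N) (ind (addsOneBox μ ν)) _)) ⟩
  ∑ (SP (suc (size μ))) (λ ν → ind (addsOneBox μ ν) * S N n ν f) ∎
  where
  rearrange₁ : ∀ v c f → v * (c * f) ≡ c * (v * f)
  rearrange₁ = solve-∀ ℚ-ring
  rearrange₂ : ∀ i c v f → i * c * (v * f) ≡ i * (v * (c * f))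
  rearrange₂ = solve-∀ ℚ-ring

-- The additional box is put at the far end of the chain, whereas `chains` peels off the near end.
-- The recursion therefore descends to `n = 0`, where `V-up` turns residues into ratios of weights
-- and leaves the factor 2.
S-step : ∀ {b μ} N n f → StrictBelow b μ → n ℕ.+ size μ ≡ N → S N n μ (step-mean f) ≡ 2ℚ * S (suc N) (suc n) μ f
S-step {μ = μ} N zero f s refl = begin
  S N 0 μ (step-mean f) ≡⟨ S-zero (step-mean f) s refl ⟩
  V μ * step-mean f μ ≡⟨ sym (∑-*ˡ (up μ) (V μ) _) ⟩
  ∑ (up μ) (λ m → V μ * (residue m * f (target m)))
    ≡⟨ ∑-congᴬ (All.map (λ {m} eq → trans (rearrange (V μ) (residue m) (f (target m)))
        (trans (cong (_* f (target m)) (sym eq)) (*-assoc 2ℚ (V (target m)) (f (target m))))) (V-up s)) ⟩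
  ∑ (up μ) (λ m → 2ℚ * (V (target m) * f (target m))) ≡⟨ ∑-*ˡ (up μ) 2ℚ _ ⟩
  2ℚ * ∑ (up μ) (λ m → V (target m) * f (target m))
    ≡⟨ cong (2ℚ *_) (sym (∑-SP-up (λ λ′ → V λ′ * f λ′) s
        (λ κ W≡0 → trans (cong (λ w → w * inv (ℕtoℚ (2 ℕ.^ length κ)) * f κ) W≡0)
        (vanish (inv (ℕtoℚ (2 ℕ.^ length κ))) (f κ))))) ⟩
  2ℚ * ∑ (SP (suc N)) (λ ν → ind (addsOneBox μ ν) * (V ν * f ν))
    ≡⟨ cong (2ℚ *_) (∑-congᴬ (All.map (λ {ν} (s , eq) → cong (ind (addsOneBox μ ν) *_) (sym (S-zero f s eq)))
        (SP-strict (suc N)))) ⟩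
  2ℚ * ∑ (SP (suc N)) (λ ν → ind (addsOneBox μ ν) * S (suc N) 0 ν f) ≡⟨ cong (2ℚ *_) (sym (S-suc (suc N) 0 μ f)) ⟩
  2ℚ * S (suc N) 1 μ f ∎
  where
  rearrange : ∀ v r f → v * (r * f) ≡ r * v * f
  rearrange = solve-∀ ℚ-ring
  vanish : ∀ i f → 0ℚ * i * f ≡ 0ℚ
  vanish = solve-∀ ℚ-ring
S-step {μ = μ} N (suc n) f s refl = begin
  S N (suc n) μ (step-mean f) ≡⟨ S-suc N n μ (step-mean f) ⟩
  ∑ (SP (suc (size μ))) (λ ν → ind (addsOneBox μ ν) * S N n ν (step-mean f))
    ≡⟨ ∑-congᴬ (All.map (λ {ν} (s , eq) → trans (cong (ind (addsOneBox μ ν) *_)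
        (S-step N n f s (trans (cong (n ℕ.+_) eq) (ℕ.+-suc n (size μ)))))
         (rearrange (ind (addsOneBox μ ν)) 2ℚ (S (suc N) (suc n) ν f))) (SP-strict (suc (size μ)))) ⟩
  ∑ (SP (suc (size μ))) (λ ν → 2ℚ * (ind (addsOneBox μ ν) * S (suc N) (suc n) ν f)) ≡⟨ ∑-*ˡ (SP (suc (size μ))) 2ℚ _ ⟩
  2ℚ * ∑ (SP (suc (size μ))) (λ ν → ind (addsOneBox μ ν) * S (suc N) (suc n) ν f) ≡⟨ cong (2ℚ *_)
      (sym (S-suc (suc N) (suc n) μ f)) ⟩
  2ℚ * S (suc N) (suc (suc n)) μ f ∎
  where
  rearrange : ∀ i t s → i * (t * s) ≡ t * (i * s)
  rearrange = solve-∀ ℚ-ring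

-- Moments of the transition measure

Seq : Set
Seq = ℕ → ℚ

conv : Seq → Seq → Seq
conv X Y zero = X 0 * Y 0
conv X Y (suc k) = X 0 * Y (suc k) + conv (X ∘ suc) Y k

-- Multiplication of a power series by 1 - a t.
L : ℚ → Seq → Seq
L a X zero = X 0
L a X (suc k) = X (suc k) - a * X k

shift : Seq → Seq
shift X zero = 0ℚ
shift X (suc k) = X k

L-shift : ∀ a X k → L a X k ≡ X k - a * shift X k
L-shift a X zero = eq a (X 0)
  where
  eq : ∀ a x → x ≡ x - a * 0ℚ
  eq = solve-∀ ℚ-ring
L-shift a X (suc k) = refl

L-injective : ∀ a X Y → (∀ k → L a X k ≡ L a Y k) → ∀ k → X k ≡ Y k
L-injective a X Y eq zero = eq 0
L-injective a X Y eq (suc k) = begin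
  X (suc k)                        ≡⟨ add-back (X (suc k)) (a * X k) ⟩
  X (suc k) - a * X k + a * X k    ≡⟨ cong₂ (λ p q → p + a * q) (eq (suc k)) (L-injective a X Y eq k) ⟩
  Y (suc k) - a * Y k + a * Y k    ≡⟨ sym (add-back (Y (suc k)) (a * Y k)) ⟩
  Y (suc k) ∎
  where
  add-back : ∀ x y → x ≡ x - y + y
  add-back = solve-∀ ℚ-ring

conv-cong : ∀ {X X′ Y Y′} → (∀ k → X k ≡ X′ k) → (∀ k → Y k ≡ Y′ k) → ∀ k → conv X Y k ≡ conv X′ Y′ k
conv-cong p q zero = cong₂ _*_ (p 0) (q 0)
conv-cong p q (suc k) = cong₂ _+_ (cong₂ _*_ (p 0) (q (suc k))) (conv-cong (p ∘ suc) q k)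

conv-zero : ∀ Y k → conv (λ _ → 0ℚ) Y k ≡ 0ℚ
conv-zero Y zero = *-zeroˡ (Y 0)
conv-zero Y (suc k) = trans (cong₂ _+_ (*-zeroˡ (Y (suc k))) (conv-zero Y k)) (+-identityʳ 0ℚ)

conv-combine : ∀ a X X′ Y k → conv (λ i → X i - a * X′ i) Y k ≡ conv X Y k - a * conv X′ Y k
conv-combine a X X′ Y zero = eq a (X 0) (X′ 0) (Y 0)
  where
  eq : ∀ a x x′ y → (x - a * x′) * y ≡ x * y - a * (x′ * y)
  eq = solve-∀ ℚ-ring
conv-combine a X X′ Y (suc k) = trans (cong ((X 0 - a * X′ 0) * Y (suc k) +_)
    (conv-combine a (X ∘ suc) (X′ ∘ suc) Y k))
    (eq a (X 0) (X′ 0) (Y (suc k)) (conv (X ∘ suc) Y k) (conv (X′ ∘ suc) Y k))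
  where
  eq : ∀ a x x′ y c c′ → (x - a * x′) * y + (c - a * c′) ≡ x * y + c - a * (x′ * y + c′)
  eq = solve-∀ ℚ-ring

L-convˡ : ∀ a X Y k → L a (conv X Y) k ≡ conv (L a X) Y k
L-convˡ a X Y zero = refl
L-convˡ a X Y (suc k) = trans (eq (X 0 * Y (suc k)) (conv (X ∘ suc) Y k) (a * conv X Y k))
    (cong (X 0 * Y (suc k) +_) (sym (conv-combine a (X ∘ suc) X Y k)))
  where
  eq : ∀ x y z → x + y - z ≡ x + (y - z)
  eq = solve-∀ ℚ-ring

L-convʳ : ∀ a X Y k → L a (conv X Y) k ≡ conv X (L a Y) k
L-convʳ a X Y zero = refl
L-convʳ a X Y (suc zero) = eq a (X 0) (X 1) (Y 0) (Y 1)
  where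
  eq : ∀ a x₀ x₁ y₀ y₁ → x₀ * y₁ + x₁ * y₀ - a * (x₀ * y₀) ≡ x₀ * (y₁ - a * y₀) + x₁ * y₀
  eq = solve-∀ ℚ-ring
L-convʳ a X Y (suc (suc k)) = trans (eq a (X 0) (Y (suc (suc k))) (Y (suc k)) (conv (X ∘ suc) Y (suc k))
    (conv (X ∘ suc) Y k))
    (cong (X 0 * (Y (suc (suc k)) - a * Y (suc k)) +_) (L-convʳ a (X ∘ suc) Y (suc k)))
  where
  eq : ∀ a x y₂ y₁ c d → x * y₂ + c - a * (x * y₁ + d) ≡ x * (y₂ - a * y₁) + (c - a * d)
  eq = solve-∀ ℚ-ring

L-geometric : ∀ a Y k → conv (L a (powℚ a)) Y k ≡ Y k
L-geometric a Y zero = *-identityˡ (Y 0)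
L-geometric a Y (suc k) = trans (cong₂ _+_ (*-identityˡ (Y (suc k)))
    (trans (conv-cong {Y = Y} (λ i → cancel (a * powℚ a i)) (λ _ → refl) k) (conv-zero Y k)))
        (+-identityʳ (Y (suc k)))
  where
  cancel : ∀ x → x - x ≡ 0ℚ
  cancel = solve-∀ ℚ-ring

-- Leibniz rule for `t d/dt` applied to `(1 - a t) X`.
L-derivative : ∀ a X k → L a (λ i → ℕtoℚ i * X i) k ≡ ℕtoℚ k * L a X k + a * shift X k
L-derivative a X zero = eq a (X 0)
  where
  eq : ∀ a x → 0ℚ * x ≡ 0ℚ * x + a * 0ℚ
  eq = solve-∀ ℚ-ring
L-derivative a X (suc k) = trans (cong (λ n → n * X (suc k) - a * (ℕtoℚ k * X k)) (ℕtoℚ-suc k))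
    (trans (eq a (X (suc k)) (X k) (ℕtoℚ k)) (cong (λ n → n * (X (suc k) - a * X k) + a * X k) (sym (ℕtoℚ-suc k))))
  where
  eq : ∀ a x y n → (1ℚ + n) * x - a * (n * y) ≡ (1ℚ + n) * (x - a * y) + a * y
  eq = solve-∀ ℚ-ring

-- Logarithmic derivative: t H′ = G H is preserved when H is multiplied by (1 - b t) / (1 - a t)
-- and Σ (aᵏ - bᵏ) tᵏ is added to G.
newton-step : ∀ a b G H H′ → (∀ k → L a H′ k ≡ L b H k) → (∀ k → ℕtoℚ k * H k ≡ conv G H k) →
  ∀ k → ℕtoℚ k * H′ k ≡ conv (λ i → powℚ a i - powℚ b i + G i) H′ k
-- Times `1 - a t`, both sides become `H′ - H + L b (conv G H)`: on the left by the Leibniz rule and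
-- `a t H′ - b t H = H′ - H`, on the right because `1 - a t` and `1 - b t` cancel the geometric
-- series.
newton-step a b G H H′ eqL eqH = L-injective a _ _ (λ k → trans (lhs k) (sym (rhs k)))
  where
  G′ : Seq
  G′ i = powℚ a i - powℚ b i + G i
  L-cong : ∀ c {X Y} → (∀ k → X k ≡ Y k) → ∀ k → L c X k ≡ L c Y k
  L-cong c p zero = p 0
  L-cong c p (suc k) = cong₂ (λ x y → x - c * y) (p (suc k)) (p k)
  lhs : ∀ k → L a (λ i → ℕtoℚ i * H′ i) k ≡ H′ k - H k + L b (conv G H) k
  lhs k = begin
    L a (λ i → ℕtoℚ i * H′ i) k ≡⟨ L-derivative a H′ k ⟩
    ℕtoℚ k * L a H′ k + a * shift H′ k ≡⟨ cong (λ x → ℕtoℚ k * x + a * shift H′ k) (eqL k) ⟩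
    ℕtoℚ k * L b H k + a * shift H′ k ≡⟨ ring₁ (ℕtoℚ k * L b H k) (a * shift H′ k) (b * shift H k) (H k) (H′ k) ⟩
    H′ k - H k + (ℕtoℚ k * L b H k + b * shift H k) + ((H k - b * shift H k) - (H′ k - a * shift H′ k))
      ≡⟨ cong₂ (λ x y → H′ k - H k + x + y) (trans (sym (L-derivative b H k)) (L-cong b eqH k))
           (trans (cong₂ _-_ (sym (L-shift b H k)) (trans (sym (L-shift a H′ k)) (eqL k))) (cancel (L b H k))) ⟩
    H′ k - H k + L b (conv G H) k + 0ℚ ≡⟨ +-identityʳ _ ⟩
    H′ k - H k + L b (conv G H) k ∎
    where
    ring₁ : ∀ x s s′ h h′ → x + s ≡ h′ - h + (x + s′) + ((h - s′) - (h′ - s))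
    ring₁ = solve-∀ ℚ-ring
    cancel : ∀ x → x - x ≡ 0ℚ
    cancel = solve-∀ ℚ-ring
  split : ∀ k → conv G′ H′ k ≡ (conv (powℚ a) H′ k - 1ℚ * conv (powℚ b) H′ k) - (- 1ℚ) * conv G H′ k
  split k = trans (conv-cong {Y = H′} (λ i → ring₂ (powℚ a i) (powℚ b i) (G i)) (λ _ → refl) k)
    (trans (conv-combine (- 1ℚ) (λ i → powℚ a i - 1ℚ * powℚ b i) G H′ k)
      (cong (λ x → x - (- 1ℚ) * conv G H′ k) (conv-combine 1ℚ (powℚ a) (powℚ b) H′ k)))
    where
    ring₂ : ∀ x y z → x - y + z ≡ (x - 1ℚ * y) - (- 1ℚ) * z
    ring₂ = solve-∀ ℚ-ring
  L-split : ∀ X Y Z k → L a (λ i → (X i - 1ℚ * Y i) - (- 1ℚ) * Z i) k ≡ L a X k - L a Y k + L a Z k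
  L-split X Y Z zero = eq (X 0) (Y 0) (Z 0)
    where
    eq : ∀ x y z → (x - 1ℚ * y) - (- 1ℚ) * z ≡ x - y + z
    eq = solve-∀ ℚ-ring
  L-split X Y Z (suc k) = eq a (X (suc k)) (X k) (Y (suc k)) (Y k) (Z (suc k)) (Z k)
    where
    eq : ∀ a x x′ y y′ z z′ → (x - 1ℚ * y) - (- 1ℚ) * z - a * ((x′ - 1ℚ * y′) - (- 1ℚ) * z′)
      ≡ x - a * x′ - (y - a * y′) + (z - a * z′)
    eq = solve-∀ ℚ-ring
  exchange : ∀ X k → L a (conv X H′) k ≡ L b (conv X H) k
  exchange X k = trans (L-convʳ a X H′ k) (trans (conv-cong {X = X} (λ _ → refl) eqL k) (sym (L-convʳ b X H k)))
  rhs : ∀ k → L a (conv G′ H′) k ≡ H′ k - H k + L b (conv G H) k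
  rhs k = trans (L-cong a split k) (trans (L-split (conv (powℚ a) H′) (conv (powℚ b) H′) (conv G H′) k)
    (cong₂ _+_ (cong₂ _-_ (trans (L-convˡ a (powℚ a) H′ k) (L-geometric a H′ k))
        (trans (exchange (powℚ b) k) (trans (L-convˡ b (powℚ b) H k) (L-geometric b H k)))) (exchange G k)))

up-moment : ℕ → List ℕ → ℚ
up-moment k λ′ = moment (up λ′) k

powerDiff : ℕ → List ℕ → ℚ
powerDiff k λ′ = ∑ λ′ (λ y → powℚ (α y) k - powℚ (β y) k)

-- With `t = u⁻¹` the moments are the coefficients of `u Φ(u)`, the product of
-- `(1 - β y t) / (1 - α y t)` over the rows, whose logarithmic derivative has the `powerDiff` as
-- coefficients.
newton : ∀ {b λ′} → StrictBelow b λ′ → ∀ k →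
  ℕtoℚ k * up-moment k λ′ ≡ conv (λ i → powerDiff i λ′) (λ i → up-moment i λ′) k
newton [] k = trans (base k) (sym (conv-zero _ k))
  where
  base : ∀ k → ℕtoℚ k * up-moment k [] ≡ 0ℚ
  base zero = refl
  base (suc k) = eq (ℕtoℚ (suc k)) (powℚ 0ℚ k)
    where
    eq : ∀ n p → n * (1ℚ * (0ℚ * p) + 0ℚ) ≡ 0ℚ
    eq = solve-∀ ℚ-ring
newton (cons {y = y} {λ′} 0<y _ s) = newton-step (α y) (β y) _ (λ i → up-moment i λ′)
    (λ i → up-moment i (y ∷ λ′)) step (newton s)
  where
  nodes = up-nodes≢ 0<y ℕ.≤-refl s
  step : ∀ k → L (α y) (λ i → up-moment i (y ∷ λ′)) k ≡ L (β y) (λ i → up-moment i λ′) k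
  step zero = trans (moment-extend-zero 0ℚ (β y) (α y) (suc y ∷ λ′) (y ∷_) (up λ′) nodes)
      (trans (cong (up-moment 0 λ′ +_) (*-zeroˡ (α y - β y))) (+-identityʳ _))
  step (suc k) = moment-extend-suc 0ℚ (β y) (α y) (suc y ∷ λ′) (y ∷_) (up λ′) k nodes

up-moment-zero : ∀ {b λ′} → StrictBelow b λ′ → up-moment 0 λ′ ≡ 1ℚ
up-moment-zero [] = refl
up-moment-zero (cons {y = y} {λ′} 0<y _ s) = trans
  (moment-extend-zero 0ℚ (β y) (α y) (suc y ∷ λ′) (y ∷_) (up λ′) (up-nodes≢ 0<y ℕ.≤-refl s))
  (trans (cong (up-moment 0 λ′ +_) (*-zeroˡ (α y - β y))) (trans (+-identityʳ _) (up-moment-zero s)))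

-- Row `i` of a shifted diagram starts in column `i`, so in every row of length `y` the difference
-- of column and row index runs through `0, …, y - 1`.
telescope : (ℚ → ℚ) → ℕ → ℚ
telescope φ zero = 0ℚ
telescope φ (suc y) = telescope φ y + φ (α y)

-- The sum of φ over the contents of the boxes of the shifted diagram.
contentSum : (ℚ → ℚ) → List ℕ → ℚ
contentSum φ λ′ = ∑ λ′ (telescope φ)

P : ℕ → List ℕ → ℚ
P k = contentSum (λ u → powℚ u k)

contentSum-up : ∀ φ λ′ → All (λ m → contentSum φ (target m) ≡ contentSum φ λ′ + φ (node m)) (up λ′)
contentSum-up φ [] = eq (φ 0ℚ) ∷ []
  where
  eq : ∀ x → 0ℚ + x + 0ℚ ≡ 0ℚ + x
  eq = solve-∀ ℚ-ring
contentSum-up φ (y ∷ λ′) = eq (telescope φ y) (φ (α y)) (contentSum φ λ′)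
  ∷ All.map⁺ (All.map (λ p → trans (cong (telescope φ y +_) p) (sym (+-assoc (telescope φ y) (contentSum φ λ′) _)))
      (contentSum-up φ λ′))
  where
  eq : ∀ w x s → w + x + s ≡ w + s + x
  eq = solve-∀ ℚ-ring

-- Γ as a filtered algebra

-- `mulP` introduces one generator at a time, so that the effect of a new box can be computed by
-- induction. `ext` asks for equality on strict partitions only, since the moment identities are
-- proved there.
data Filt : ℕ → (List ℕ → ℚ) → Set where
  const : ∀ {d} c → Filt d (λ _ → c)
  add   : ∀ {d f h} → Filt d f → Filt d h → Filt d (λ λ′ → f λ′ + h λ′)
  mulP  : ∀ k {d e f} → suc (k ℕ.+ d) ≤ e → Filt d f → Filt e (λ λ′ → P k λ′ * f λ′)
  ext   : ∀ {d f h} → (∀ {b λ′} → StrictBelow b λ′ → f λ′ ≡ h λ′) → Filt d f → Filt d h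

raise : ∀ {d e f} → d ≤ e → Filt d f → Filt e f
raise d≤e (const c) = const c
raise d≤e (add p q) = add (raise d≤e p) (raise d≤e q)
raise d≤e (mulP k le p) = mulP k (ℕ.≤-trans le d≤e) p
raise d≤e (ext eq p) = ext eq (raise d≤e p)

scale : ∀ {d f} c → Filt d f → Filt d (λ λ′ → c * f λ′)
scale c (const c′) = const (c * c′)
scale c (add {f = f} {h} p q) = ext (λ {_} {λ′} _ → eq c (f λ′) (h λ′)) (add (scale c p) (scale c q))
  where
  eq : ∀ c x y → c * x + c * y ≡ c * (x + y)
  eq = solve-∀ ℚ-ring
scale c (mulP k {f = f} le p) = ext (λ {_} {λ′} _ → eq c (P k λ′) (f λ′)) (mulP k le (scale c p))
  where
  eq : ∀ c x y → x * (c * y) ≡ c * (x * y)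
  eq = solve-∀ ℚ-ring
scale c (ext eq p) = ext (λ s → cong (c *_) (eq s)) (scale c p)

mul : ∀ {d e f h} → Filt d f → Filt e h → Filt (d ℕ.+ e) (λ λ′ → f λ′ * h λ′)
mul {d} (const c) q = raise (ℕ.m≤n+m _ d) (scale c q)
mul {h = h} (add {f = f} {f′} p p′) q = ext (λ {_} {λ′} _ → eq (f λ′) (f′ λ′) (h λ′)) (add (mul p q) (mul p′ q))
  where
  eq : ∀ x y z → x * z + y * z ≡ (x + y) * z
  eq = solve-∀ ℚ-ring
mul {e = e} {h = h} (mulP k {d} {d′} {f} le p) q = ext (λ {_} {λ′} _ → sym (*-assoc (P k λ′) (f λ′) (h λ′)))
  (mulP k (subst (_≤ d′ ℕ.+ e) (cong suc (ℕ.+-assoc k d e)) (ℕ.+-monoˡ-≤ e le)) (mul p q))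
mul {h = h} (ext eq p) q = ext (λ {_} {λ′} s → cong (_* h λ′) (eq s)) (mul p q)

-- Content sums of polynomials, and the odd power sums

data PolyDeg : ℕ → (ℚ → ℚ) → Set where
  const : ∀ {d} c → PolyDeg d (λ _ → c)
  add   : ∀ {d φ ψ} → PolyDeg d φ → PolyDeg d ψ → PolyDeg d (λ u → φ u + ψ u)
  mulU  : ∀ {d φ} → PolyDeg d φ → PolyDeg (suc d) (λ u → u * φ u)
  ext   : ∀ {d φ ψ} → (∀ u → φ u ≡ ψ u) → PolyDeg d φ → PolyDeg d ψ

raisePoly : ∀ {d φ} → PolyDeg d φ → PolyDeg (suc d) φ
raisePoly (const c) = const c
raisePoly (add p q) = add (raisePoly p) (raisePoly q)
raisePoly (mulU p) = mulU (raisePoly p)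
raisePoly (ext eq p) = ext eq (raisePoly p)

scalePoly : ∀ {d φ} c → PolyDeg d φ → PolyDeg d (λ u → c * φ u)
scalePoly c (const c′) = const (c * c′)
scalePoly c (add {φ = φ} {ψ} p q) = ext (λ u → eq c (φ u) (ψ u)) (add (scalePoly c p) (scalePoly c q))
  where
  eq : ∀ c x y → c * x + c * y ≡ c * (x + y)
  eq = solve-∀ ℚ-ring
scalePoly c (mulU {φ = φ} p) = ext (λ u → eq c u (φ u)) (mulU (scalePoly c p))
  where
  eq : ∀ c x y → x * (c * y) ≡ c * (x * y)
  eq = solve-∀ ℚ-ring
scalePoly c (ext eq p) = ext (λ u → cong (c *_) (eq u)) (scalePoly c p)

polyPow : ∀ k → PolyDeg k (λ u → powℚ u k)
polyPow zero = const 1ℚ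
polyPow (suc k) = mulU (polyPow k)

telescope-cong : ∀ {φ ψ} → (∀ u → φ u ≡ ψ u) → ∀ y → telescope φ y ≡ telescope ψ y
telescope-cong eq zero = refl
telescope-cong eq (suc y) = cong₂ _+_ (telescope-cong eq y) (eq (α y))

telescope-+ : ∀ φ ψ y → telescope (λ u → φ u + ψ u) y ≡ telescope φ y + telescope ψ y
telescope-+ φ ψ zero = refl
telescope-+ φ ψ (suc y) = trans (cong (_+ (φ (α y) + ψ (α y))) (telescope-+ φ ψ y))
    (eq (telescope φ y) (telescope ψ y) (φ (α y)) (ψ (α y)))
  where
  eq : ∀ a b c d → a + b + (c + d) ≡ a + c + (b + d)
  eq = solve-∀ ℚ-ring

telescope-* : ∀ φ c y → telescope (λ u → φ u * c) y ≡ telescope φ y * c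
telescope-* φ c zero = sym (*-zeroˡ c)
telescope-* φ c (suc y) = trans (cong (_+ φ (α y) * c) (telescope-* φ c y)) (eq (telescope φ y) (φ (α y)) c)
  where
  eq : ∀ a b c → a * c + b * c ≡ (a + b) * c
  eq = solve-∀ ℚ-ring

-- The exponent `j` accumulates the factors `u` met on the way down to a constant `c`, where the
-- content sum is `c` times `P j`.
contentSum-shifted : ∀ {d φ} → PolyDeg d φ → ∀ j → Filt (suc (j ℕ.+ d)) (contentSum (λ u → powℚ u j * φ u))
contentSum-shifted {d} (const c) j = ext (λ {_} {λ′} _ → sym
    (trans (∑-cong λ′ (telescope-* (λ u → powℚ u j) c)) (∑-*ʳ λ′ c _)))
  (mulP j {d = 0} (s≤s (ℕ.+-monoʳ-≤ j z≤n)) (const c))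
contentSum-shifted (add {φ = φ} {ψ} p q) j = ext (λ {_} {λ′} _ → sym (trans
    (∑-cong λ′ (λ y → trans (telescope-cong (λ u → eq (powℚ u j) (φ u) (ψ u)) y)
        (telescope-+ (λ u → powℚ u j * φ u) (λ u → powℚ u j * ψ u) y)))
    (∑-+ λ′ _ _)))
  (add (contentSum-shifted p j) (contentSum-shifted q j))
  where
  eq : ∀ p x y → p * (x + y) ≡ p * x + p * y
  eq = solve-∀ ℚ-ring
contentSum-shifted (mulU {d} {φ} p) j = ext (λ {_} {λ′} _ → ∑-cong λ′ (telescope-cong (λ u → eq u (powℚ u j) (φ u))))
  (subst (λ n → Filt (suc n) (contentSum (λ u → powℚ u (suc j) * φ u))) (sym (ℕ.+-suc j d))
      (contentSum-shifted p (suc j)))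
  where
  eq : ∀ u p x → u * p * x ≡ p * (u * x)
  eq = solve-∀ ℚ-ring
contentSum-shifted (ext eq p) j = ext (λ {_} {λ′} _ → ∑-cong λ′ (telescope-cong (λ u → cong (powℚ u j *_) (eq u))))
    (contentSum-shifted p j)

contentSum-Filt : ∀ {d φ} → PolyDeg d φ → Filt (suc d) (contentSum φ)
contentSum-Filt {φ = φ} p = ext (λ {_} {λ′} _ → ∑-cong λ′ (telescope-cong (λ u → *-identityˡ (φ u))))
    (contentSum-shifted p 0)

-- With u = α y, the numbers α (suc y) and β y are the roots of X² - (2u + 2) X + (u² - 2u); this yields the
-- recurrence for α (suc y)ʳ - 2 uʳ + (β y)ʳ, and the cancellation of the leading terms the degree r - 1.
secondDiff : ℕ → ℚ → ℚ
secondDiff zero u = 0ℚ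
secondDiff (suc zero) u = 1ℚ + 1ℚ
secondDiff (suc (suc r)) u =
  (u + u + (1ℚ + 1ℚ)) * secondDiff (suc r) u - (u * u - (u + u)) * secondDiff r u
  -- The sequence `- 2 uʳ` fails the recurrence of the two roots; its defect is `8 uʳ⁺¹`.
  + (1ℚ + 1ℚ) * (1ℚ + 1ℚ) * (1ℚ + 1ℚ) * powℚ u (suc r)

secondDiff-α : ∀ r y → secondDiff r (α y) ≡ powℚ (α (suc y)) r - (powℚ (α y) r + powℚ (α y) r) + powℚ (β y) r
secondDiff-α r y = trans (go r) (cong (λ a → powℚ a r - (powℚ (α y) r + powℚ (α y) r) + powℚ (β y) r)
    (sym (cong (λ s → s * (1ℚ + s)) (ℕtoℚ-suc y))))
  where
  q = ℕtoℚ y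
  s = (1ℚ + q) * (1ℚ + (1ℚ + q))
  one : ∀ q → 1ℚ + 1ℚ ≡ (1ℚ + q) * (1ℚ + (1ℚ + q)) * 1ℚ - (q * (1ℚ + q) * 1ℚ + q * (1ℚ + q) * 1ℚ) + q * (q - 1ℚ) * 1ℚ
  one = solve-∀ ℚ-ring
  rec : ∀ q S U T →
    (q * (1ℚ + q) + q * (1ℚ + q) + (1ℚ + 1ℚ)) * ((1ℚ + q) * (1ℚ + (1ℚ + q)) * S -
        (q * (1ℚ + q) * U + q * (1ℚ + q) * U) + q * (q - 1ℚ) * T)
      - (q * (1ℚ + q) * (q * (1ℚ + q)) - (q * (1ℚ + q) + q * (1ℚ + q))) * (S - (U + U) + T)
      + (1ℚ + 1ℚ) * (1ℚ + 1ℚ) * (1ℚ + 1ℚ) * (q * (1ℚ + q) * U)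
    ≡ (1ℚ + q) * (1ℚ + (1ℚ + q)) * ((1ℚ + q) * (1ℚ + (1ℚ + q)) * S)
      - (q * (1ℚ + q) * (q * (1ℚ + q) * U) + q * (1ℚ + q) * (q * (1ℚ + q) * U)) + q * (q - 1ℚ) * (q * (q - 1ℚ) * T)
  rec = solve-∀ ℚ-ring
  go : ∀ r → secondDiff r (α y) ≡ powℚ s r - (powℚ (α y) r + powℚ (α y) r) + powℚ (β y) r
  go zero = refl
  go (suc zero) = one q
  go (suc (suc r)) = trans (cong₂ (λ x x′ → (α y + α y + (1ℚ + 1ℚ)) * x - (α y * α y - (α y + α y)) * x′ +
      (1ℚ + 1ℚ) * (1ℚ + 1ℚ) * (1ℚ + 1ℚ) * powℚ (α y) (suc r))
      (go (suc r)) (go r)) (rec q (powℚ s r) (powℚ (α y) r) (powℚ (β y) r))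

secondDiff-telescope : ∀ r y → telescope (secondDiff r) y ≡ powℚ (α y) r - powℚ (β y) r
secondDiff-telescope r zero = cancel (powℚ 0ℚ r)
  where
  cancel : ∀ x → 0ℚ ≡ x - x
  cancel = solve-∀ ℚ-ring
secondDiff-telescope r (suc y) = trans (cong₂ _+_ (secondDiff-telescope r y) (secondDiff-α r y))
  (trans (eq (powℚ (α (suc y)) r) (powℚ (α y) r) (powℚ (β y) r))
      (cong (λ b → powℚ (α (suc y)) r - powℚ b r) (sym (β-suc y))))
  where
  eq : ∀ x y z → y - z + (x - (y + y) + z) ≡ x - y
  eq = solve-∀ ℚ-ring

secondDiff-deg : ∀ r → PolyDeg r (secondDiff (suc r))
secondDiff-deg zero = const _
-- The recurrence reaches back to `secondDiff 0`, which is 0 and would need degree -1; hence the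
-- explicit case.
secondDiff-deg (suc zero) = ext eq (add (mulU (const ((1ℚ + 1ℚ + (1ℚ + 1ℚ)) + (1ℚ + 1ℚ) * (1ℚ + 1ℚ) * (1ℚ + 1ℚ))))
    (const ((1ℚ + 1ℚ) * (1ℚ + 1ℚ))))
  where
  eq : ∀ u → u * ((1ℚ + 1ℚ + (1ℚ + 1ℚ)) + (1ℚ + 1ℚ) * (1ℚ + 1ℚ) * (1ℚ + 1ℚ)) + (1ℚ + 1ℚ) * (1ℚ + 1ℚ)
    ≡ (u + u + (1ℚ + 1ℚ)) * (1ℚ + 1ℚ) - (u * u - (u + u)) * 0ℚ + (1ℚ + 1ℚ) * (1ℚ + 1ℚ) * (1ℚ + 1ℚ) * (u * 1ℚ)
  eq = solve-∀ ℚ-ring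
secondDiff-deg (suc (suc r)) = ext (λ u → eq u (secondDiff (suc (suc r)) u) (secondDiff (suc r) u)
    (powℚ u (suc (suc r))))
  (add (add (scalePoly (1ℚ + 1ℚ) (add (mulU (secondDiff-deg (suc r))) (raisePoly (secondDiff-deg (suc r)))))
            (add (scalePoly (- 1ℚ) (mulU (mulU (secondDiff-deg r))))
                (scalePoly (1ℚ + 1ℚ) (mulU (raisePoly (secondDiff-deg r))))))
       (scalePoly ((1ℚ + 1ℚ) * (1ℚ + 1ℚ) * (1ℚ + 1ℚ)) (polyPow (suc (suc r)))))
  where
  eq : ∀ u x y z → (1ℚ + 1ℚ) * (u * x + x) + ((- 1ℚ) * (u * (u * y)) + (1ℚ + 1ℚ) * (u * y)) + (1ℚ + 1ℚ) *
      (1ℚ + 1ℚ) * (1ℚ + 1ℚ) * z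
    ≡ (u + u + (1ℚ + 1ℚ)) * x - (u * u - (u + u)) * y + (1ℚ + 1ℚ) * (1ℚ + 1ℚ) * (1ℚ + 1ℚ) * z
  eq = solve-∀ ℚ-ring

-- The second difference has degree only `r` in `u`, and the content sum adds 1. A bound larger by
-- one would spoil degree `K` for the `K`-th moment.
powerDiff-Filt : ∀ r → Filt (suc r) (powerDiff (suc r))
powerDiff-Filt r = ext (λ {_} {λ′} _ → ∑-cong λ′ (secondDiff-telescope (suc r))) (contentSum-Filt (secondDiff-deg r))

-- With u = y (y + 1), the squares (y + 1)² and y² are the roots of X² - (2u + 1) X + u²; this yields the
-- recurrence for (y + 1)²ᵏ⁺¹ - y²ᵏ⁺¹.
oddDiff : ℕ → ℚ → ℚ
oddDiff zero u = 1ℚ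
oddDiff (suc zero) u = (1ℚ + 1ℚ + 1ℚ) * u + 1ℚ
oddDiff (suc (suc k)) u = (u + u + 1ℚ) * oddDiff (suc k) u - u * (u * oddDiff k u)

powℚ-double : ∀ q k → powℚ q (2 ℕ.* k) ≡ powℚ (q * q) k
powℚ-double q zero = refl
powℚ-double q (suc k) = trans (cong (λ n → q * powℚ q n) (ℕ.+-suc k (k ℕ.+ 0)))
  (trans (sym (*-assoc q q _)) (cong (q * q *_) (powℚ-double q k)))

-- Here oddness matters: the increment of an odd power from `y` to `y + 1` is invariant under
-- `y ↦ - 1 - y`, hence a polynomial in `y (y + 1)`.
oddDiff-telescope : ∀ k y → telescope (oddDiff k) y ≡ powℚ (ℕtoℚ y) (suc (2 ℕ.* k))
oddDiff-telescope k zero = sym (*-zeroˡ (powℚ 0ℚ (2 ℕ.* k)))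
oddDiff-telescope k (suc y) = begin
  telescope (oddDiff k) y + oddDiff k (α y) ≡⟨ cong₂ _+_
      (trans (oddDiff-telescope k y) (cong (q *_) (powℚ-double q k))) (go k) ⟩
  q * powℚ (q * q) k + ((1ℚ + q) * powℚ s k - q * powℚ (q * q) k) ≡⟨ cancel (q * powℚ (q * q) k)
      ((1ℚ + q) * powℚ s k) ⟩
  (1ℚ + q) * powℚ s k ≡⟨ cong (λ p → p * powℚ (p * p) k) (sym (ℕtoℚ-suc y)) ⟩
  ℕtoℚ (suc y) * powℚ (ℕtoℚ (suc y) * ℕtoℚ (suc y)) k ≡⟨ cong (ℕtoℚ (suc y) *_) (sym (powℚ-double (ℕtoℚ (suc y)) k)) ⟩
  powℚ (ℕtoℚ (suc y)) (suc (2 ℕ.* k)) ∎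
  where
  q = ℕtoℚ y
  s = (1ℚ + q) * (1ℚ + q)
  cancel : ∀ a b → a + (b - a) ≡ b
  cancel = solve-∀ ℚ-ring
  zero′ : ∀ q → 1ℚ ≡ (1ℚ + q) * 1ℚ - q * 1ℚ
  zero′ = solve-∀ ℚ-ring
  one : ∀ q → (1ℚ + 1ℚ + 1ℚ) * (q * (1ℚ + q)) + 1ℚ ≡ (1ℚ + q) * ((1ℚ + q) * (1ℚ + q) * 1ℚ) - q * (q * q * 1ℚ)
  one = solve-∀ ℚ-ring
  rec : ∀ q A B →
    (q * (1ℚ + q) + q * (1ℚ + q) + 1ℚ) * ((1ℚ + q) * ((1ℚ + q) * (1ℚ + q) * A) - q * (q * q * B))
      - q * (1ℚ + q) * (q * (1ℚ + q) * ((1ℚ + q) * A - q * B))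
    ≡ (1ℚ + q) * ((1ℚ + q) * (1ℚ + q) * ((1ℚ + q) * (1ℚ + q) * A)) - q * (q * q * (q * q * B))
  rec = solve-∀ ℚ-ring
  go : ∀ k → oddDiff k (α y) ≡ (1ℚ + q) * powℚ s k - q * powℚ (q * q) k
  go zero = zero′ q
  go (suc zero) = one q
  go (suc (suc k)) = trans (cong₂ (λ x x′ → (α y + α y + 1ℚ) * x - α y * (α y * x′)) (go (suc k)) (go k))
      (rec q (powℚ s k) (powℚ (q * q) k))

oddDiff-deg : ∀ k → PolyDeg k (oddDiff k)
oddDiff-deg zero = const 1ℚ
oddDiff-deg (suc zero) = add (ext (λ u → *-comm u _) (mulU (const (1ℚ + 1ℚ + 1ℚ)))) (const 1ℚ)
oddDiff-deg (suc (suc k)) = ext (λ u → eq u (oddDiff (suc k) u) (oddDiff k u))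
  (add (add (scalePoly (1ℚ + 1ℚ) (mulU (oddDiff-deg (suc k)))) (raisePoly (oddDiff-deg (suc k))))
      (scalePoly (- 1ℚ) (mulU (mulU (oddDiff-deg k)))))
  where
  eq : ∀ u x y → (1ℚ + 1ℚ) * (u * x) + x + (- 1ℚ) * (u * (u * y)) ≡ (u + u + 1ℚ) * x - u * (u * y)
  eq = solve-∀ ℚ-ring

evalΓ-Filt : ∀ f → ∃ λ d → Filt d (evalΓ f)
evalΓ-Filt (const c) = 0 , const c
evalΓ-Filt (pOdd k) = suc k , ext (λ {_} {λ′} _ → trans (∑-cong λ′ (oddDiff-telescope k)) (sym (sumℚ-map _ λ′)))
    (contentSum-Filt (oddDiff-deg k))
evalΓ-Filt (f ⊕ h) with evalΓ-Filt f | evalΓ-Filt h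
... | d , p | e , q = d ℕ.+ e , add (raise (ℕ.m≤m+n d e) p) (raise (ℕ.m≤n+m e d) q)
evalΓ-Filt (f ⊗ h) with evalΓ-Filt f | evalΓ-Filt h
... | d , p | e , q = d ℕ.+ e , mul p q

-- The offset `e` absorbs the shift of `X` in the recursion of `conv`; `Y` is controlled only up to
-- `k` because it will stand for moments already treated.
conv-Filt : ∀ {X Y : ℕ → List ℕ → ℚ} e k → (∀ i → Filt (e ℕ.+ i) (X i)) → (∀ j → j ≤ k → Filt j (Y j)) →
  Filt (e ℕ.+ k) (λ λ′ → conv (λ i → X i λ′) (λ j → Y j λ′) k)
conv-Filt e zero p q = raise (ℕ.≤-reflexive (ℕ.+-identityʳ (e ℕ.+ 0))) (mul (p 0) (q 0 z≤n))
conv-Filt {X} {Y} e (suc k) p q = add (raise (ℕ.+-monoˡ-≤ (suc k) (ℕ.≤-reflexive (ℕ.+-identityʳ e)))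
    (mul (p 0) (q (suc k) ℕ.≤-refl)))
  (raise (ℕ.≤-reflexive (sym (ℕ.+-suc e k))) (conv-Filt {X ∘ suc} {Y} (suc e) k
    (λ i → raise (ℕ.≤-reflexive (ℕ.+-suc e i)) (p (suc i))) (λ j j≤k → q j (ℕ.m≤n⇒m≤1+n j≤k))))

up-moment-Filt : ∀ k → Filt k (up-moment k)
up-moment-Filt k = go k k ℕ.≤-refl
  where
  go : ∀ k j → j ≤ k → Filt j (up-moment j)
  go k zero _ = ext (λ s → sym (up-moment-zero s)) (const 1ℚ)
  go (suc k) (suc j) (s≤s j≤k) = ext eq (scale (inv (ℕtoℚ (suc j)))
      (conv-Filt {powerDiff ∘ suc} {up-moment} 1 j powerDiff-Filt (λ i i≤j → go k i (ℕ.≤-trans i≤j j≤k))))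
    where
    eq : ∀ {b λ′} → StrictBelow b λ′ →
      inv (ℕtoℚ (suc j)) * conv (λ i → powerDiff (suc i) λ′) (λ i → up-moment i λ′) j ≡ up-moment (suc j) λ′
    eq {λ′ = λ′} s = *-cancelˡ (ℕtoℚ-suc≢0 j) (begin
      N * (inv N * C) ≡⟨ trans (sym (*-assoc N (inv N) C))
          (cong (_* C) (trans (*-comm N (inv N)) (inv-* (ℕtoℚ-suc≢0 j)))) ⟩
      -- `powerDiff 0` vanishes, so the convolution involves only lower moments and Newton's
      -- identity can be solved for the new one.
      1ℚ * C ≡⟨ unit C (up-moment (suc j) λ′) ⟩
      0ℚ * up-moment (suc j) λ′ + C ≡⟨ cong (λ z → z * up-moment (suc j) λ′ + C) (sym (∑-zero λ′)) ⟩
      conv (λ i → powerDiff i λ′) (λ i → up-moment i λ′) (suc j) ≡⟨ sym (newton s (suc j)) ⟩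
      N * up-moment (suc j) λ′ ∎)
      where
      N = ℕtoℚ (suc j)
      C = conv (λ i → powerDiff (suc i) λ′) (λ i → up-moment i λ′) j
      unit : ∀ c h → 1ℚ * c ≡ 0ℚ * h + c
      unit = solve-∀ ℚ-ring

-- Lowering of the degree and polynomiality

inv≢0 : ∀ {x} → x ≢ 0ℚ → inv x ≢ 0ℚ
inv≢0 {x} x≢0 eq with () ← trans (sym (inv-* x≢0)) (trans (cong (_* x) eq) (*-zeroˡ x))

R≢0 : ∀ {b y λ′} → 0 < y → b ≤ y → StrictBelow b λ′ → R y λ′ ≢ 0ℚ
R≢0 _ _ [] ()
R≢0 0<y b≤y (cons {y = z} 0<z z<b s) =
  *-≢0 (*-≢0 (-≢0′ (ℕ.<-≤-trans z<b b≤y)) (inv≢0 (+≢0 z 0<y))) (R≢0 0<y (ℕ.≤-trans (ℕ.<⇒≤ z<b) b≤y) s)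

ℕtoℚ≢0 : ∀ n .{{_ : ℕ.NonZero n}} → ℕtoℚ n ≢ 0ℚ
ℕtoℚ≢0 (suc n) = ℕtoℚ-suc≢0 n

W≢0 : ∀ {b λ′} → StrictBelow b λ′ → W λ′ ≢ 0ℚ
W≢0 [] ()
W≢0 (cons {y = y} 0<y _ s) = *-≢0 (*-≢0 (W≢0 s) (inv≢0 (ℕtoℚ≢0 (y !) {{ℕ._!≢0 y}}))) (R≢0 0<y ℕ.≤-refl s)

V≢0 : ∀ {b λ′} → StrictBelow b λ′ → V λ′ ≢ 0ℚ
V≢0 {λ′ = λ′} s = *-≢0 (W≢0 s) (inv≢0 (ℕtoℚ≢0 (2 ℕ.^ length λ′) {{ℕ.m^n≢0 2 (length λ′)}}))

-- If the target has weight 0, then `V-up` forces residue 0 because `V λ′` is nonzero. Hence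
-- equality on strict partitions survives averaging.
up-strict : ∀ {b λ′} → StrictBelow b λ′ → All (λ m → (∃ λ c → StrictBelow c (target m)) ⊎ residue m ≡ 0ℚ) (up λ′)
up-strict {λ′ = λ′} s = All.zipWith (λ {m} → go m) (up-target ℕ.z<s (StrictBelow-size s) , V-up s)
  where
  go : ∀ m → (StrictBelow (suc (suc (size λ′))) (target m) ⊎ W (target m) ≡ 0ℚ)
    × 2ℚ * V (target m) ≡ residue m * V λ′ →
    (∃ λ c → StrictBelow c (target m)) ⊎ residue m ≡ 0ℚ
  go m (inj₁ s′ , _) = inj₁ (_ , s′)
  go m (inj₂ W≡0 , eq) = inj₂ (*-cancelˡ (V≢0 s) (begin
    V λ′ * residue m ≡⟨ *-comm (V λ′) (residue m) ⟩
    residue m * V λ′ ≡⟨ sym eq ⟩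
    2ℚ * (W (target m) * h) ≡⟨ cong (λ w → 2ℚ * (w * h)) W≡0 ⟩
    2ℚ * (0ℚ * h) ≡⟨ vanish 2ℚ h (V λ′) ⟩
    V λ′ * 0ℚ ∎))
    where
    h = inv (ℕtoℚ (2 ℕ.^ length (target m)))
    vanish : ∀ t h v → t * (0ℚ * h) ≡ v * 0ℚ
    vanish = solve-∀ ℚ-ring

-- The mean of `u ^ K * f` after one step, `u` being the content of the new box. All `K` are needed
-- at once: pulling a factor `P k` out of `f` creates a term with `K + k`.
twisted : ℕ → (List ℕ → ℚ) → List ℕ → ℚ
twisted K f λ′ = ∑ (up λ′) (λ m → residue m * powℚ (node m) K * f (target m))

twisted-cong : ∀ K {f h} → (∀ {b λ′} → StrictBelow b λ′ → f λ′ ≡ h λ′) → ∀ {b λ′} → StrictBelow b λ′ → twisted K f λ′ ≡ twisted K h λ′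
twisted-cong K {f} {h} eq s = ∑-congᴬ (All.map (λ {m} → go m) (up-strict s))
  where
  vanish : ∀ p x y → 0ℚ * p * x ≡ 0ℚ * p * y
  vanish = solve-∀ ℚ-ring
  go : ∀ m → (∃ λ c → StrictBelow c (target m)) ⊎ residue m ≡ 0ℚ →
    residue m * powℚ (node m) K * f (target m) ≡ residue m * powℚ (node m) K * h (target m)
  go m (inj₁ (_ , s)) = cong (residue m * powℚ (node m) K *_) (eq s)
  go m (inj₂ r≡0) = trans (cong (λ r → r * powℚ (node m) K * f (target m)) r≡0)
    (trans (vanish (powℚ (node m) K) (f (target m)) (h (target m)))
        (cong (λ r → r * powℚ (node m) K * h (target m)) (sym r≡0)))

twisted-+ : ∀ K f h λ′ → twisted K (λ ν → f ν + h ν) λ′ ≡ twisted K f λ′ + twisted K h λ′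
twisted-+ K f h λ′ = trans (∑-cong (up λ′) (λ m → eq (residue m * powℚ (node m) K) (f (target m)) (h (target m))))
    (∑-+ (up λ′) _ _)
  where
  eq : ∀ a x y → a * (x + y) ≡ a * x + a * y
  eq = solve-∀ ℚ-ring

powℚ-+ : ∀ q j k → powℚ q (j ℕ.+ k) ≡ powℚ q j * powℚ q k
powℚ-+ q zero k = sym (*-identityˡ (powℚ q k))
powℚ-+ q (suc j) k = trans (cong (q *_) (powℚ-+ q j k)) (sym (*-assoc q (powℚ q j) (powℚ q k)))

twisted-P : ∀ K k f λ′ → twisted K (λ ν → P k ν * f ν) λ′ ≡ P k λ′ * twisted K f λ′ + twisted (K ℕ.+ k) f λ′
twisted-P K k f λ′ = begin
  twisted K (λ ν → P k ν * f ν) λ′ ≡⟨ ∑-congᴬ (All.map (λ {m} → go m) (contentSum-up (λ u → powℚ u k) λ′)) ⟩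
  ∑ (up λ′) (λ m → P k λ′ * (residue m * powℚ (node m) K * f (target m)) + residue m * powℚ (node m) (K ℕ.+ k) * f
      (target m))
    ≡⟨ ∑-+ (up λ′) _ _ ⟩
  _ ≡⟨ cong (_+ twisted (K ℕ.+ k) f λ′) (∑-*ˡ (up λ′) (P k λ′) _) ⟩
  P k λ′ * twisted K f λ′ + twisted (K ℕ.+ k) f λ′ ∎
  where
  eq : ∀ r p x q f → r * p * ((x + q) * f) ≡ x * (r * p * f) + r * (p * q) * f
  eq = solve-∀ ℚ-ring
  go : ∀ m → P k (target m) ≡ P k λ′ + powℚ (node m) k →
    residue m * powℚ (node m) K * (P k (target m) * f (target m))
    ≡ P k λ′ * (residue m * powℚ (node m) K * f (target m)) + residue m * powℚ (node m) (K ℕ.+ k) * f (target m)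
  go m p = trans (cong (λ x → residue m * powℚ (node m) K * (x * f (target m))) p)
    (trans (eq (residue m) (powℚ (node m) K) (P k λ′) (powℚ (node m) k) (f (target m)))
      (cong (λ q → P k λ′ * (residue m * powℚ (node m) K * f (target m)) + residue m * q * f (target m))
          (sym (powℚ-+ (node m) K k))))

twisted-Filt : ∀ {d f} K → Filt d f → Filt (K ℕ.+ d) (twisted K f)
twisted-Filt {d} K (const c) = ext (λ {_} {λ′} _ → trans (*-comm c _) (sym (∑-*ʳ (up λ′) c _)))
    (scale c (raise (ℕ.m≤m+n K d) (up-moment-Filt K)))
twisted-Filt K (add {f = f} {h} p q) = ext (λ {_} {λ′} _ → sym (twisted-+ K f h λ′))
    (add (twisted-Filt K p) (twisted-Filt K q))
twisted-Filt K (mulP k {d} {e} {f} le p) = ext (λ {_} {λ′} _ → sym (twisted-P K k f λ′))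
  (add (mulP k (ℕ.≤-trans (ℕ.≤-reflexive (swap (suc k))) (ℕ.+-monoʳ-≤ K le)) (twisted-Filt K p))
       (raise (ℕ.≤-trans (ℕ.≤-reflexive (ℕ.+-assoc K k d)) (ℕ.+-monoʳ-≤ K (ℕ.≤-trans (ℕ.n≤1+n (k ℕ.+ d)) le)))
           (twisted-Filt (K ℕ.+ k) p)))
  where
  swap : ∀ x → x ℕ.+ (K ℕ.+ d) ≡ K ℕ.+ (x ℕ.+ d)
  swap x = trans (sym (ℕ.+-assoc x K d)) (trans (cong (ℕ._+ d) (ℕ.+-comm x K)) (ℕ.+-assoc K x d))
twisted-Filt K (ext eq p) = ext (twisted-cong K eq) (twisted-Filt K p)

step-mean-twisted : ∀ f λ′ → step-mean f λ′ ≡ twisted 0 f λ′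
step-mean-twisted f λ′ = ∑-cong (up λ′) (λ m → cong (_* f (target m)) (sym (*-identityʳ (residue m))))

difference : (List ℕ → ℚ) → List ℕ → ℚ
difference f λ′ = step-mean f λ′ - f λ′

-- Degree less than `d`, where degree less than 0 means zero on strict partitions.
Below : ℕ → (List ℕ → ℚ) → Set
Below zero f = ∀ {b λ′} → StrictBelow b λ′ → f λ′ ≡ 0ℚ
Below (suc d) f = Filt d f

Below-ext : ∀ d {f h} → (∀ {b λ′} → StrictBelow b λ′ → f λ′ ≡ h λ′) → Below d f → Below d h
Below-ext zero eq p s = trans (sym (eq s)) (p s)
Below-ext (suc d) eq p = ext eq p

Below-add : ∀ d {f h} → Below d f → Below d h → Below d (λ λ′ → f λ′ + h λ′)
Below-add zero p q s = cong₂ _+_ (p s) (q s)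
Below-add (suc d) p q = add p q

Below-zero : ∀ d → Below d (λ _ → 0ℚ)
Below-zero zero _ = refl
Below-zero (suc d) = const 0ℚ

-- A constant is killed by total mass 1. For a product, the difference of `P k * f` is `P k` times
-- that of `f` plus `twisted k f`, whose degree exceeds that of `f` by `k` rather than `k + 1`.
difference-lowers : ∀ {d f} → Filt d f → Below d (difference f)
difference-lowers {d} (const c) = Below-ext d (λ {_} {λ′} s → sym (begin
    step-mean (λ _ → c) λ′ - c ≡⟨ cong (_- c) (trans (step-mean-twisted _ λ′) (∑-*ʳ (up λ′) c _)) ⟩
    up-moment 0 λ′ * c - c ≡⟨ cong (λ h → h * c - c) (up-moment-zero s) ⟩
    1ℚ * c - c ≡⟨ eq c ⟩
    0ℚ ∎)) (Below-zero d)
  where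
  eq : ∀ c → 1ℚ * c - c ≡ 0ℚ
  eq = solve-∀ ℚ-ring
difference-lowers {d} (add {f = f} {h} p q) = Below-ext d (λ {_} {λ′} _ → sym (trans
    (cong (_- (f λ′ + h λ′)) (trans (step-mean-twisted _ λ′)
        (trans (twisted-+ 0 f h λ′) (sym (cong₂ _+_ (step-mean-twisted f λ′) (step-mean-twisted h λ′))))))
    (eq (step-mean f λ′) (step-mean h λ′) (f λ′) (h λ′)))) (Below-add d (difference-lowers p) (difference-lowers q))
  where
  eq : ∀ a b c d → a + b - (c + d) ≡ a - c + (b - d)
  eq = solve-∀ ℚ-ring
difference-lowers (mulP k {d} {suc e} {f} (s≤s le) p) = ext (λ {_} {λ′} _ → sym (trans
    (cong (_- P k λ′ * f λ′) (trans (step-mean-twisted _ λ′)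
        (trans (twisted-P 0 k f λ′) (cong (λ t → P k λ′ * t + twisted k f λ′) (sym (step-mean-twisted f λ′))))))
    (eq (P k λ′) (step-mean f λ′) (twisted k f λ′) (f λ′))))
    (add (first d le (difference-lowers p)) (raise le (twisted-Filt k p)))
  where
  eq : ∀ p s t f → p * s + t - p * f ≡ p * (s - f) + t
  eq = solve-∀ ℚ-ring
  -- For `f` of degree 0 the difference is zero, so the product is a constant and `mulP` with degree
  -- `d - 1` does not arise.
  first : ∀ d → k ℕ.+ d ≤ e → Below d (difference f) → Filt e (λ λ′ → P k λ′ * difference f λ′)
  first zero _ p = ext (λ {_} {λ′} s → sym (trans (cong (P k λ′ *_) (p s)) (*-zeroʳ (P k λ′)))) (const 0ℚ)
  first (suc d) le p = mulP k (ℕ.≤-trans (ℕ.≤-reflexive (sym (ℕ.+-suc k d))) le) p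
difference-lowers {d} (ext {f = f} {h} eq p) = Below-ext d (λ {_} {λ′} s → cong₂ _-_
    (trans (step-mean-twisted f λ′) (trans (twisted-cong 0 eq s) (sym (step-mean-twisted h λ′)))) (eq s))
        (difference-lowers p)

-- Polynomial functions and Newton's forward difference formula

Polynomial : (ℕ → ℚ) → Set
Polynomial φ = Σ (List ℚ) (λ cs → ∀ n → φ n ≡ evalPoly cs n)

addPoly : List ℚ → List ℚ → List ℚ
addPoly [] ds = ds
addPoly (c ∷ cs) [] = c ∷ cs
addPoly (c ∷ cs) (d ∷ ds) = c + d ∷ addPoly cs ds

evalPoly-add : ∀ cs ds n → evalPoly (addPoly cs ds) n ≡ evalPoly cs n + evalPoly ds n
evalPoly-add [] ds n = sym (+-identityˡ (evalPoly ds n))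
evalPoly-add (c ∷ cs) [] n = sym (+-identityʳ _)
evalPoly-add (c ∷ cs) (d ∷ ds) n = trans (cong (λ e → c + d + ℕtoℚ n * e) (evalPoly-add cs ds n))
    (eq c d (ℕtoℚ n) (evalPoly cs n) (evalPoly ds n))
  where
  eq : ∀ c d n x y → c + d + n * (x + y) ≡ c + n * x + (d + n * y)
  eq = solve-∀ ℚ-ring

evalPoly-scale : ∀ a cs n → evalPoly (map (a *_) cs) n ≡ a * evalPoly cs n
evalPoly-scale a [] n = sym (*-zeroʳ a)
evalPoly-scale a (c ∷ cs) n = trans (cong (λ e → a * c + ℕtoℚ n * e) (evalPoly-scale a cs n))
    (eq a c (ℕtoℚ n) (evalPoly cs n))
  where
  eq : ∀ a c n x → a * c + n * (a * x) ≡ a * (c + n * x)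
  eq = solve-∀ ℚ-ring

polynomial-add : ∀ {φ ψ} → Polynomial φ → Polynomial ψ → Polynomial (λ n → φ n + ψ n)
polynomial-add (cs , p) (ds , q) = addPoly cs ds , λ n → trans (cong₂ _+_ (p n) (q n)) (sym (evalPoly-add cs ds n))

polynomial-scale : ∀ {φ} a → Polynomial φ → Polynomial (λ n → a * φ n)
polynomial-scale a (cs , p) = map (a *_) cs , λ n → trans (cong (a *_) (p n)) (sym (evalPoly-scale a cs n))

polynomial-var : ∀ {φ} → Polynomial φ → Polynomial (λ n → ℕtoℚ n * φ n)
polynomial-var (cs , p) = 0ℚ ∷ cs , λ n → trans (cong (ℕtoℚ n *_) (p n)) (sym (+-identityˡ _))

polynomial-cong : ∀ {φ ψ} → (∀ n → φ n ≡ ψ n) → Polynomial φ → Polynomial ψ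
polynomial-cong eq (cs , p) = cs , λ n → trans (sym (eq n)) (p n)

binom : ℕ → ℕ → ℚ
binom zero n = 1ℚ
binom (suc j) zero = 0ℚ
binom (suc j) (suc n) = binom (suc j) n + binom j n

-- Turns Pascal's recursion in `n` into a product recursion in `j`, from which each binomial is seen
-- to be a polynomial in `n`.
binom-absorb : ∀ j n → ℕtoℚ (suc j) * binom (suc j) n ≡ (ℕtoℚ n - ℕtoℚ j) * binom j n
binom-absorb zero zero = refl
binom-absorb (suc j) zero = trans (*-zeroʳ (ℕtoℚ (suc (suc j)))) (sym (*-zeroʳ (0ℚ - ℕtoℚ (suc j))))
binom-absorb zero (suc n) = trans (eq (binom 1 n))
    (trans (cong (_+ 1ℚ) (binom-absorb zero n)) (trans (eq′ (ℕtoℚ n))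
    (cong (λ s → (s - 0ℚ) * 1ℚ) (sym (ℕtoℚ-suc n)))))
  where
  eq : ∀ b → 1ℚ * (b + 1ℚ) ≡ 1ℚ * b + 1ℚ
  eq = solve-∀ ℚ-ring
  eq′ : ∀ n → (n - 0ℚ) * 1ℚ + 1ℚ ≡ (1ℚ + n - 0ℚ) * 1ℚ
  eq′ = solve-∀ ℚ-ring
binom-absorb (suc j) (suc n) = begin
  ℕtoℚ (suc (suc j)) * (x + y) ≡⟨ eq₁ (ℕtoℚ (suc (suc j))) x y ⟩
  ℕtoℚ (suc (suc j)) * x + ℕtoℚ (suc (suc j)) * y ≡⟨ cong₂ (λ p q → p + q * y) (binom-absorb (suc j) n)
      (ℕtoℚ-suc (suc j)) ⟩
  (ℕtoℚ n - ℕtoℚ (suc j)) * y + (1ℚ + ℕtoℚ (suc j)) * y ≡⟨ eq₂ (ℕtoℚ n) (ℕtoℚ (suc j)) y ⟩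
  (1ℚ + ℕtoℚ n - ℕtoℚ (suc j)) * y + ℕtoℚ (suc j) * y ≡⟨ cong ((1ℚ + ℕtoℚ n - ℕtoℚ (suc j)) * y +_)
      (binom-absorb j n) ⟩
  (1ℚ + ℕtoℚ n - ℕtoℚ (suc j)) * y + (ℕtoℚ n - ℕtoℚ j) * z ≡⟨ cong
      (λ s → (1ℚ + ℕtoℚ n - s) * y + (ℕtoℚ n - ℕtoℚ j) * z) (ℕtoℚ-suc j) ⟩
  (1ℚ + ℕtoℚ n - (1ℚ + ℕtoℚ j)) * y + (ℕtoℚ n - ℕtoℚ j) * z ≡⟨ eq₃ (ℕtoℚ n) (ℕtoℚ j) y z ⟩
  (1ℚ + ℕtoℚ n - (1ℚ + ℕtoℚ j)) * (y + z) ≡⟨ cong₂ (λ s t → (s - t) * (y + z)) (sym (ℕtoℚ-suc n)) (sym (ℕtoℚ-suc j)) ⟩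
  (ℕtoℚ (suc n) - ℕtoℚ (suc j)) * (y + z) ∎
  where
  x = binom (suc (suc j)) n
  y = binom (suc j) n
  z = binom j n
  eq₁ : ∀ a x y → a * (x + y) ≡ a * x + a * y
  eq₁ = solve-∀ ℚ-ring
  eq₂ : ∀ n j y → (n - j) * y + (1ℚ + j) * y ≡ (1ℚ + n - j) * y + j * y
  eq₂ = solve-∀ ℚ-ring
  eq₃ : ∀ n j y z → (1ℚ + n - (1ℚ + j)) * y + (n - j) * z ≡ (1ℚ + n - (1ℚ + j)) * (y + z)
  eq₃ = solve-∀ ℚ-ring

polynomial-binom : ∀ j → Polynomial (binom j)
polynomial-binom zero = 1ℚ ∷ [] , λ n → sym (trans (cong (1ℚ +_) (*-zeroʳ (ℕtoℚ n))) (+-identityʳ 1ℚ))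
polynomial-binom (suc j) = polynomial-cong
  (λ n → *-cancelˡ (ℕtoℚ-suc≢0 j) (trans (eq n) (sym (binom-absorb j n))))
  (polynomial-scale (inv N) (polynomial-add (polynomial-var (polynomial-binom j))
      (polynomial-scale (- ℕtoℚ j) (polynomial-binom j))))
  where
  N = ℕtoℚ (suc j)
  rearrange : ∀ N i n j b → N * (i * (n * b + - j * b)) ≡ i * N * ((n - j) * b)
  rearrange = solve-∀ ℚ-ring
  eq : ∀ n → N * (inv N * (ℕtoℚ n * binom j n + - ℕtoℚ j * binom j n)) ≡ (ℕtoℚ n - ℕtoℚ j) * binom j n
  eq n = trans (rearrange N (inv N) (ℕtoℚ n) (ℕtoℚ j) (binom j n))
    (trans (cong (_* ((ℕtoℚ n - ℕtoℚ j) * binom j n)) (inv-* (ℕtoℚ-suc≢0 j)))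
        (*-identityˡ ((ℕtoℚ n - ℕtoℚ j) * binom j n)))

evalBinom : ℕ → List ℚ → ℕ → ℚ
evalBinom j [] n = 0ℚ
evalBinom j (c ∷ cs) n = c * binom j n + evalBinom (suc j) cs n

polynomial-evalBinom : ∀ j cs → Polynomial (evalBinom j cs)
polynomial-evalBinom j [] = [] , λ _ → refl
polynomial-evalBinom j (c ∷ cs) = polynomial-add (polynomial-scale c (polynomial-binom j))
    (polynomial-evalBinom (suc j) cs)

evalBinom-suc : ∀ j cs n → evalBinom (suc j) cs (suc n) ≡ evalBinom (suc j) cs n + evalBinom j cs n
evalBinom-suc j [] n = refl
evalBinom-suc j (c ∷ cs) n = trans (cong (c * (binom (suc j) n + binom j n) +_) (evalBinom-suc (suc j) cs n))
  (eq c (binom (suc j) n) (binom j n) (evalBinom (suc (suc j)) cs n) (evalBinom (suc j) cs n))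
  where
  eq : ∀ c x y p q → c * (x + y) + (p + q) ≡ c * x + p + (c * y + q)
  eq = solve-∀ ℚ-ring

evalBinom-zero : ∀ j cs → evalBinom (suc j) cs 0 ≡ 0ℚ
evalBinom-zero j [] = refl
evalBinom-zero j (c ∷ cs) = trans (cong₂ _+_ (*-zeroʳ c) (evalBinom-zero (suc j) cs)) (+-identityʳ 0ℚ)

-- Discrete integration in the binomial basis raises each index by one, and the initial value
-- becomes the constant coefficient.
summation : ∀ (φ : ℕ → ℚ) cs → (∀ n → φ (suc n) ≡ φ n + evalBinom 0 cs n) → ∀ n → φ n ≡ evalBinom 0 (φ 0 ∷ cs) n
summation φ cs eq zero = sym (trans (cong₂ _+_ (*-identityʳ (φ 0)) (evalBinom-zero 0 cs)) (+-identityʳ (φ 0)))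
summation φ cs eq (suc n) = begin
  φ (suc n) ≡⟨ eq n ⟩
  φ n + evalBinom 0 cs n ≡⟨ cong (_+ evalBinom 0 cs n) (summation φ cs eq n) ⟩
  φ 0 * 1ℚ + evalBinom 1 cs n + evalBinom 0 cs n ≡⟨ +-assoc (φ 0 * 1ℚ) _ _ ⟩
  φ 0 * 1ℚ + (evalBinom 1 cs n + evalBinom 0 cs n) ≡⟨ cong (φ 0 * 1ℚ +_) (sym (evalBinom-suc 0 cs n)) ⟩
  φ 0 * 1ℚ + evalBinom 1 cs (suc n) ∎

-- The expectation as a function of n

E : List ℕ → ℕ → (List ℕ → ℚ) → ℚ
E μ n f = powℚ 2ℚ n * S (n ℕ.+ size μ) n μ f

-- The power of 2 in `E` absorbs the factor 2 of `S-step`.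
E-suc : ∀ {b μ} → StrictBelow b μ → ∀ n f → E μ (suc n) f ≡ E μ n (step-mean f)
E-suc {μ = μ} s n f = trans (rearrange 2ℚ (powℚ 2ℚ n) (S (suc n ℕ.+ size μ) (suc n) μ f))
    (cong (powℚ 2ℚ n *_) (sym (S-step (n ℕ.+ size μ) n f s refl)))
  where
  rearrange : ∀ t p s → t * p * s ≡ p * (t * s)
  rearrange = solve-∀ ℚ-ring

E-cong : ∀ μ n {f h} → (∀ {b λ′} → StrictBelow b λ′ → f λ′ ≡ h λ′) → E μ n f ≡ E μ n h
E-cong μ n eq = cong (powℚ 2ℚ n *_) (∑-congᴬ (All.map
    (λ {λ′} (s , _) → cong (λ x → V λ′ * (chainsℚ n μ λ′ * x)) (eq s)) (SP-strict (n ℕ.+ size μ))))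

E-+ : ∀ μ n f h → E μ n (λ λ′ → f λ′ + h λ′) ≡ E μ n f + E μ n h
E-+ μ n f h = trans (cong (powℚ 2ℚ n *_) (trans (∑-cong (SP (n ℕ.+ size μ))
    (λ λ′ → eq (V λ′) (chainsℚ n μ λ′) (f λ′) (h λ′))) (∑-+ (SP (n ℕ.+ size μ)) _ _)))
  (eq′ (powℚ 2ℚ n) _ _)
  where
  eq : ∀ v c x y → v * (c * (x + y)) ≡ v * (c * x) + v * (c * y)
  eq = solve-∀ ℚ-ring
  eq′ : ∀ p x y → p * (x + y) ≡ p * x + p * y
  eq′ = solve-∀ ℚ-ring

E-zero : ∀ μ n → E μ n (λ _ → 0ℚ) ≡ 0ℚ
E-zero μ n = trans (cong (powℚ 2ℚ n *_) (trans (∑-cong (SP (n ℕ.+ size μ)) (λ λ′ → eq (V λ′) (chainsℚ n μ λ′)))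
    (∑-zero (SP (n ℕ.+ size μ))))) (*-zeroʳ (powℚ 2ℚ n))
  where
  eq : ∀ v c → v * (c * 0ℚ) ≡ 0ℚ
  eq = solve-∀ ℚ-ring

E-difference : ∀ {b μ} → StrictBelow b μ → ∀ f n → E μ (suc n) f ≡ E μ n f + E μ n (difference f)
E-difference {μ = μ} s f n = trans (E-suc s n f) (trans
    (E-cong μ n (λ {_} {λ′} _ → add-back (step-mean f λ′) (f λ′))) (E-+ μ n f (difference f)))
  where
  add-back : ∀ x y → x ≡ y + (x - y)
  add-back = solve-∀ ℚ-ring

-- The forward difference in `n` is the expectation of `difference f`, which has smaller degree; the
-- recursion ends when that function is zero.
E-binomial : ∀ {b μ} → StrictBelow b μ → ∀ d {f} → Filt d f → ∃ λ cs → ∀ n → E μ n f ≡ evalBinom 0 cs n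
E-binomial {μ = μ} s d {f} p with d | difference-lowers p
... | zero | q = E μ 0 f ∷ [] , summation (λ n → E μ n f) []
    (λ n → trans (E-difference s f n) (cong (E μ n f +_) (trans (E-cong μ n q) (E-zero μ n))))
... | suc d | q with E-binomial s d q
... | cs , eq = E μ 0 f ∷ cs , summation (λ n → E μ n f) cs
    (λ n → trans (E-difference s f n) (cong (E μ n f +_) (eq n)))

IsStrict⇒StrictBelow : ∀ {μ} → IsStrict μ → ∃ λ b → StrictBelow b μ
IsStrict⇒StrictBelow {[]} _ = 0 , []
IsStrict⇒StrictBelow {y ∷ μ} (ps , ls) = suc y , go ps ls
  where
  go : ∀ {y μ} → All (0 <_) (y ∷ μ) → Linked (λ a b → b < a) (y ∷ μ) → StrictBelow (suc y) (y ∷ μ)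
  go (0<y ∷ []) [-] = cons 0<y ℕ.≤-refl []
  go (0<y ∷ ps) (z<y ∷ ls) = cons 0<y ℕ.≤-refl (weaken z<y (go ps ls))

ℕtoℚ-2^ : ∀ n → ℕtoℚ (2 ℕ.^ n) ≡ powℚ 2ℚ n
ℕtoℚ-2^ zero = refl
ℕtoℚ-2^ (suc n) = trans (ℕtoℚ-* 2 (2 ℕ.^ n)) (cong (2ℚ *_) (ℕtoℚ-2^ n))

norm : List ℕ → ℚ
norm μ = ℕtoℚ (size μ !) * ℕtoℚ (2 ℕ.^ length μ) * inv (ℕtoℚ (g μ))

-- By the hook formula `g λ′ / (n + m)!` is `W λ′`, so the factorial depending on `n` cancels and
-- all that depends on `μ` alone is collected in `norm μ`.
expect≡E : ∀ μ n f → expect μ n f ≡ norm μ * E μ n (evalΓ f)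
expect≡E μ n f = begin
  expect μ n f ≡⟨ sumℚ-map _ (SP N) ⟩
  ∑ (SP N) _ ≡⟨ ∑-congᴬ (All.map (λ {λ′} (s , eq) → summand λ′ s eq) (SP-strict N)) ⟩
  ∑ (SP N) (λ λ′ → c * (V λ′ * (chainsℚ n μ λ′ * evalΓ f λ′))) ≡⟨ ∑-*ˡ (SP N) c _ ⟩
  c * S N n μ (evalΓ f) ≡⟨ *-assoc (norm μ) (powℚ 2ℚ n) _ ⟩
  norm μ * E μ n (evalΓ f) ∎
  where
  N = n ℕ.+ size μ
  c = norm μ * powℚ 2ℚ n
  M = ℕtoℚ (size μ !)
  F = ℕtoℚ (N !)
  num : List ℕ → ℕ
  num λ′ = size μ ! ℕ.* 2 ℕ.^ (n ℕ.+ length μ) ℕ.* g λ′ ℕ.* gskew λ′ μ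
  den : List ℕ → ℕ
  den λ′ = N ! ℕ.* 2 ℕ.^ length λ′ ℕ.* g μ
  rearrange : ∀ m t t′ F w ch e iF ih ig →
    m * (t * t′) * (F * w) * ch * e * (iF * ih * ig) ≡ m * t′ * ig * t * (w * ih * (ch * e)) * (iF * F)
  rearrange = solve-∀ ℚ-ring
  num≡ : ∀ λ′ → StrictBelow (suc N) λ′ → size λ′ ≡ N →
    ℕtoℚ (num λ′) ≡ M * (powℚ 2ℚ n * ℕtoℚ (2 ℕ.^ length μ)) * (F * W λ′) * chainsℚ n μ λ′
  num≡ λ′ s eq = begin
    ℕtoℚ (num λ′) ≡⟨ ℕtoℚ-* (size μ ! ℕ.* 2 ℕ.^ (n ℕ.+ length μ) ℕ.* g λ′) (gskew λ′ μ) ⟩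
    ℕtoℚ (size μ ! ℕ.* 2 ℕ.^ (n ℕ.+ length μ) ℕ.* g λ′) * ℕtoℚ (gskew λ′ μ)
      ≡⟨ cong₂ _*_ (ℕtoℚ-* (size μ ! ℕ.* 2 ℕ.^ (n ℕ.+ length μ)) (g λ′))
           (cong (λ k → chainsℚ k μ λ′) (trans (cong (ℕ._∸ size μ) eq) (ℕ.m+n∸n≡m n (size μ)))) ⟩
    ℕtoℚ (size μ ! ℕ.* 2 ℕ.^ (n ℕ.+ length μ)) * ℕtoℚ (g λ′) * chainsℚ n μ λ′
      ≡⟨ cong₂ (λ p q → p * q * chainsℚ n μ λ′) (ℕtoℚ-* (size μ !) (2 ℕ.^ (n ℕ.+ length μ)))
           (trans (shifted-hook s) (cong (λ k → ℕtoℚ (k !) * W λ′) eq)) ⟩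
    M * ℕtoℚ (2 ℕ.^ (n ℕ.+ length μ)) * (F * W λ′) * chainsℚ n μ λ′
      ≡⟨ cong (λ p → M * p * (F * W λ′) * chainsℚ n μ λ′) (trans (ℕtoℚ-2^ (n ℕ.+ length μ))
           (trans (powℚ-+ 2ℚ n (length μ)) (cong (powℚ 2ℚ n *_) (sym (ℕtoℚ-2^ (length μ)))))) ⟩
    M * (powℚ 2ℚ n * ℕtoℚ (2 ℕ.^ length μ)) * (F * W λ′) * chainsℚ n μ λ′ ∎
  den≡ : ∀ λ′ → inv (ℕtoℚ (den λ′)) ≡ inv F * inv (ℕtoℚ (2 ℕ.^ length λ′)) * inv (ℕtoℚ (g μ))
  den≡ λ′ = begin
    inv (ℕtoℚ (den λ′)) ≡⟨ cong inv (ℕtoℚ-* (N ! ℕ.* 2 ℕ.^ length λ′) (g μ)) ⟩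
    inv (ℕtoℚ (N ! ℕ.* 2 ℕ.^ length λ′) * ℕtoℚ (g μ)) ≡⟨ inv-distrib-* (ℕtoℚ (N ! ℕ.* 2 ℕ.^ length λ′)) (ℕtoℚ (g μ)) ⟩
    inv (ℕtoℚ (N ! ℕ.* 2 ℕ.^ length λ′)) * inv (ℕtoℚ (g μ))
      ≡⟨ cong (λ q → inv q * inv (ℕtoℚ (g μ))) (ℕtoℚ-* (N !) (2 ℕ.^ length λ′)) ⟩
    inv (F * ℕtoℚ (2 ℕ.^ length λ′)) * inv (ℕtoℚ (g μ)) ≡⟨ cong (_* inv (ℕtoℚ (g μ)))
        (inv-distrib-* F (ℕtoℚ (2 ℕ.^ length λ′))) ⟩
    inv F * inv (ℕtoℚ (2 ℕ.^ length λ′)) * inv (ℕtoℚ (g μ)) ∎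
  summand : ∀ λ′ → StrictBelow (suc N) λ′ → size λ′ ≡ N →
    divℕ (ℕtoℚ (num λ′) * evalΓ f λ′) (den λ′) ≡ c * (V λ′ * (chainsℚ n μ λ′ * evalΓ f λ′))
  summand λ′ s eq = begin
    divℕ (ℕtoℚ (num λ′) * evalΓ f λ′) (den λ′) ≡⟨ divℕ-inv (ℕtoℚ (num λ′) * evalΓ f λ′) (den λ′) ⟩
    ℕtoℚ (num λ′) * evalΓ f λ′ * inv (ℕtoℚ (den λ′)) ≡⟨ cong₂ (λ p q → p * evalΓ f λ′ * q) (num≡ λ′ s eq) (den≡ λ′) ⟩
    _ ≡⟨ rearrange M (powℚ 2ℚ n) (ℕtoℚ (2 ℕ.^ length μ)) F (W λ′) (chainsℚ n μ λ′) (evalΓ f λ′)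
           (inv F) (inv (ℕtoℚ (2 ℕ.^ length λ′))) (inv (ℕtoℚ (g μ))) ⟩
    c * (V λ′ * (chainsℚ n μ λ′ * evalΓ f λ′)) * (inv F * F)
      ≡⟨ sym (insert-1 _ (inv-* (ℕtoℚ≢0 (N !) {{ℕ._!≢0 N}}))) ⟩
    c * (V λ′ * (chainsℚ n μ λ′ * evalΓ f λ′)) ∎

theorem1p3 : (μ : List ℕ) → IsStrict μ → (f : Γ) →
    Σ (List ℚ) (λ cs → (n : ℕ) → expect μ n f ≡ evalPoly cs n)
theorem1p3 μ strict f with IsStrict⇒StrictBelow strict | evalΓ-Filt f
... | _ , s | d , p with E-binomial s d p
... | cs , eq = polynomial-cong (λ n → trans (cong (norm μ *_) (sym (eq n))) (sym (expect≡E μ n f)))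
                  (polynomial-scale (norm μ) (polynomial-evalBinom 0 cs))
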